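{- Let $G$ be a (simple, finite) bipartite graph with maximum degree at most $3$ such that $d(u)+d(v)\le 5$ for every edge $uv$ of $G$. Then $\chi_s'(G) \le 6$.
   Context: $d(u)$ denotes the degree of vertex $u$. A strong edge coloring of a graph $G$ is a proper edge coloring in which each color class is an induced matching of $G$; equivalently, any two distinct edges at distance at most two (i.e., edges that share a vertex or are joined by an edge) receive distinct colors. The strong chromatic index $\chi_s'(G)$ is the minimum number of colors in a strong edge coloring of $G$. -}

module Defs where

open import Data.Nat using (ℕ; _+_; _≤_)
open import Data.Bool using (Bool; true; false; if_then_else_)
open import Data.Fin using (Fin)
open import Data.List using (map; allFin)
open import Data.Nat.ListAction using (sum)
open import Data.Product using (Σ; _×_; _,_)
open import Data.Sum using (_⊎_)
open import Relation.Binary.PropositionalEquality using (_≡_; _≢_)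
open import Relation.Nullary using (¬_)

record Graph (n : ℕ) : Set where
  field
    adj     : Fin n → Fin n → Bool
    sym     : ∀ u v → adj u v ≡ adj v u
    irrefl  : ∀ u → adj u u ≡ false

module _ {n : ℕ} (G : Graph n) where
  open Graph G

  Edge : Fin n → Fin n → Set
  Edge u v = adj u v ≡ true

  deg : Fin n → ℕ
  deg u = sum (map (λ v → if adj u v then 1 else 0) (allFin n))

  MaxDegreeAtMost : ℕ → Set
  MaxDegreeAtMost D = ∀ u → deg u ≤ D

  Bipartite : Set
  Bipartite = Σ (Fin n → Bool) λ side → ∀ u v → Edge u v → side u ≢ side v

  SameEdge : Fin n → Fin n → Fin n → Fin n → Set
  SameEdge u v x y = (u ≡ x × v ≡ y) ⊎ (u ≡ y × v ≡ x)

  -- edges uv and xy are at distance at most two: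
  -- they share a vertex, or are joined by an edge
  Close : Fin n → Fin n → Fin n → Fin n → Set
  Close u v x y =
    (u ≡ x ⊎ u ≡ y ⊎ v ≡ x ⊎ v ≡ y)
    ⊎ (Edge u x ⊎ Edge u y ⊎ Edge v x ⊎ Edge v y)

  record StrongEdgeColoring (k : ℕ) : Set where
    field
      colour     : Fin n → Fin n → Fin k
      colour-sym : ∀ u v → Edge u v → colour u v ≡ colour v u
      strong     : ∀ u v x y → Edge u v → Edge x y →
                   ¬ SameEdge u v x y → Close u v x y →
                   colour u v ≢ colour x y

  StrongChromaticIndexAtMost : ℕ → Set
  StrongChromaticIndexAtMost k = StrongEdgeColoring k

{-# OPTIONS --safe #-}
-- Call one side of G rows and the other columns. A row r whose columns s_i all have degree at most 2 is reducible:
-- colour the graph without r and the s_i, let t_i be the other neighbour of s_i, and colour the edges r s_i and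
-- t_i s_i. Writing Y_i for the colours at t_i, I_i for those one step beyond, and X_i for the complement
-- of Y_i ∪ I_i, we have |Y_i| ≤ 2 and |I_i| ≤ 2, hence |X_i| ≥ 2. If the X_i are disjoint, take both colours of r s_i
-- and t_i s_i from X_i; if two of them meet, give the two edges t_i s_i the common colour, and then the edges r s_i
-- have distinct representatives, unless the Y_i are one and the same pair of colours. In that case the colours
-- at t_0 can be changed, by recolouring at most two edges near t_0, without affecting Y_1. Coinciding t_i are easy.
-- All rows of degree 3 have such columns. Once they are removed, the columns qualify in the same way.
module Submission where

open import Defs
open import Data.Nat using (ℕ; zero; suc; _+_; _*_; _≤_; _<_; z≤n; s≤s; s≤s⁻¹)
open import Data.Nat.Properties using (≤-refl; ≤-trans; ≤-reflexive; +-mono-≤; +-monoˡ-≤; *-monoˡ-≤; +-cancelˡ-≤; ≰⇒>; _≤?_)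
open import Data.Bool using (Bool; true; false; if_then_else_)
import Data.Bool.Properties as Bool
open import Data.Empty using (⊥; ⊥-elim)
open import Data.Fin using (Fin; zero; suc; #_)
open import Data.Fin.Properties using (_≟_; any?; pigeonhole; <⇒≢)
open import Data.List using (List; []; _∷_; _++_; map; length; filter; allFin; lookup)
open import Data.List.Properties using (filter-notAll; length-filter; length-++; length-map)
open import Data.List.Membership.Propositional using (_∈_; _∉_)
open import Data.List.Membership.Propositional.Properties using (∈-filter⁺; ∈-map⁺; ∈-++⁺ˡ; ∈-++⁺ʳ; ∈-allFin)
open import Data.List.Relation.Unary.All as All using (All; []; _∷_)
open import Data.List.Relation.Unary.All.Properties using (all-filter; ¬Any⇒All¬)
open import Data.List.Relation.Unary.AllPairs using ([]; _∷_)
open import Data.List.Relation.Unary.Any as Any using (here; there)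
open import Data.List.Relation.Unary.Any.Properties using (lookup-index)
open import Data.List.Relation.Unary.Unique.Propositional using (Unique)
open import Data.Nat.ListAction using (sum)
open import Data.Product using (Σ; ∃; _×_; _,_; proj₁; proj₂; swap)
open import Data.Product.Properties using (≡-dec)
open import Data.Sum as Sum using (_⊎_; inj₁; inj₂; [_,_]′)
open import Function using (_∘_; flip; case_of_)
open import Relation.Binary.Definitions using (DecidableEquality)
open import Relation.Binary.PropositionalEquality using (_≡_; _≢_; refl; sym; trans; cong; subst; ≢-sym)
open import Relation.Nullary using (¬_; Dec; yes; no; contradiction)
open import Relation.Nullary.Decidable using (True; toWitness; ¬?; _×-dec_)

-- Cardinality bounds by covering lists

module _ {X : Set} where

  -- Only an upper bound: the list may repeat entries and may contain elements outside `P`, so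
  -- passing to a subset needs no decision procedure.
  AtMost : ℕ → (X → Set) → Set
  AtMost k P = ∃ λ l → length l ≤ k × (∀ {x} → P x → x ∈ l)

  atMost-⊆ : ∀ {k} {P Q : X → Set} → (∀ {x} → Q x → P x) → AtMost k P → AtMost k Q
  atMost-⊆ Q⊆P (l , len , cover) = l , len , cover ∘ Q⊆P

  atMost-exact : ∀ {k} {P : X → Set} → (∀ x → Dec (P x)) → AtMost k P →
                 ∃ λ l → length l ≤ k × (∀ {x} → P x → x ∈ l) × All P l
  atMost-exact P? (l , len , cover) =
    filter P? l , ≤-trans (length-filter P? l) len , (λ p → ∈-filter⁺ P? (cover p) p) , all-filter P? l

  atMost₁ : ∀ {P : X → Set} → (∀ x → Dec (P x)) → AtMost 1 P →
            (∀ x → ¬ P x) ⊎ (∃ λ y → P y × (∀ {x} → P x → x ≡ y))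
  atMost₁ P? m with atMost-exact P? m
  ... | [] , _ , cover , _ = inj₁ λ x p → case cover p of λ ()
  ... | y ∷ [] , _ , cover , py ∷ [] = inj₂ (y , py , λ p → case cover p of λ { (here e) → e })
  ... | _ ∷ _ ∷ _ , s≤s () , _

  -- Sets with fewer than two elements are encoded by `y ≡ z`, so membership is promised only when
  -- the two differ; `d` fills in when `P` is empty.
  atMost₂ : ∀ {P : X → Set} → X → (∀ x → Dec (P x)) → AtMost 2 P →
            ∃ λ y → ∃ λ z → (∀ {x} → P x → x ≡ y ⊎ x ≡ z) × (y ≢ z → P y × P z)
  atMost₂ d P? m with atMost-exact P? m
  ... | [] , _ , cover , _ = d , d , (λ p → case cover p of λ ()) , (λ d≢d → contradiction refl d≢d)
  ... | y ∷ [] , _ , cover , _ =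
    y , y , (λ p → case cover p of λ { (here e) → inj₁ e }) , (λ y≢y → contradiction refl y≢y)
  ... | y ∷ z ∷ [] , _ , cover , py ∷ pz ∷ [] =
    y , z , (λ p → case cover p of λ { (here e) → inj₁ e ; (there (here e)) → inj₂ e }) , (λ _ → py , pz)
  ... | _ ∷ _ ∷ _ ∷ _ , s≤s (s≤s ()) , _

  module _ (_≟ₓ_ : DecidableEquality X) where

    atMost-remove : ∀ {k x} {P : X → Set} → P x → AtMost (suc k) P → AtMost k (λ y → P y × y ≢ x)
    atMost-remove {x = x} p (l , len , cover) =
      filter ≢x? l ,
      s≤s⁻¹ (≤-trans (filter-notAll ≢x? l (Any.map (λ e ¬e → ¬e (sym e)) (cover p))) len) ,
      λ (q , y≢x) → ∈-filter⁺ ≢x? (cover q) y≢x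
      where
      ≢x? : ∀ y → Dec (y ≢ x)
      ≢x? y = ¬? (y ≟ₓ x)

    atMost₂-overfull : ∀ {x y z} {P : X → Set} → AtMost 2 P → P x → P y → P z → y ≢ x → z ≢ x → z ≢ y → ⊥
    atMost₂-overfull m px py pz y≢x z≢x z≢y with atMost-remove (py , y≢x) (atMost-remove px m)
    ... | [] , _ , cover = case cover ((pz , z≢x) , z≢y) of λ ()

atMost-Σ : ∀ {X Y : Set} {j k} {Q : Y → Set} {P : Y → X → Set} → (∀ y → Dec (Q y)) → AtMost j Q →
           (∀ {y} → Q y → AtMost k (P y)) →
           ∃ λ (l : List (X × Y)) → length l ≤ j * k × (∀ {x y} → Q y → P y x → (x , y) ∈ l)
atMost-Σ {X} {Y} {j} {k} {Q} {P} Q? m each with atMost-exact Q? m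
... | ys , len , cover , qs with gather ys qs
  where
  gather : ∀ ys → All Q ys → ∃ λ (l : List (X × Y)) → length l ≤ length ys * k ×
           (∀ {x y} → y ∈ ys → P y x → (x , y) ∈ l)
  gather [] [] = [] , z≤n , λ ()
  gather (y ∷ ys) (q ∷ qs) with each q | gather ys qs
  ... | l , len , cover | l′ , len′ , cover′ =
    map (_, y) l ++ l′ ,
    ≤-trans (≤-reflexive (trans (length-++ (map (_, y) l)) (cong (_+ length l′) (length-map (_, y) l)))) (+-mono-≤ len len′) ,
    λ { (here refl) p → ∈-++⁺ˡ (∈-map⁺ (_, y) (cover p)) ; (there i) p → ∈-++⁺ʳ _ (cover′ i p) }
... | l , len′ , cover′ = l , ≤-trans len′ (*-monoˡ-≤ k len) , λ q p → cover′ (cover q) p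

search : ∀ {m} {P : Set} {Q : Fin m → Set} → (∀ i → P ⊎ Q i) → P ⊎ (∀ i → Q i)
search {zero} f = inj₂ λ ()
search {suc m} f with f zero | search (f ∘ suc)
... | inj₁ p | _ = inj₁ p
... | inj₂ _ | inj₁ p = inj₁ p
... | inj₂ q | inj₂ qs = inj₂ λ { zero → q ; (suc i) → qs i }

-- Six colours and the pigeonhole principle

Colour : Set
Colour = Fin 6

infix 4 _∈?_
_∈?_ : ∀ {n} (k : Fin n) l → Dec (k ∈ l)
k ∈? l = Any.any? (k ≟_) l

-- If all six colours occurred in `l`, their positions would map six colours into at most five
-- places, and two colours would share one.
fresh-≤ : (l : List Colour) → length l ≤ 5 → ∃ λ k → All (k ≢_) l
fresh-≤ l len with any? (λ k → ¬? (k ∈? l))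
... | yes (k , k∉l) = k , ¬Any⇒All¬ l k∉l
... | no none = contradiction (trans (lookup-index (at i)) (trans (cong (lookup l) eq) (sym (lookup-index (at j))))) (<⇒≢ i<j)
  where
  at : ∀ k → k ∈ l
  at k with k ∈? l
  ... | yes k∈l = k∈l
  ... | no k∉l = contradiction (k , k∉l) none
  clash = pigeonhole (s≤s len) (Any.index ∘ at)
  i = proj₁ clash
  j = proj₁ (proj₂ clash)
  i<j = proj₁ (proj₂ (proj₂ clash))
  eq = proj₂ (proj₂ (proj₂ clash))

-- For a list of known length the bound is settled by evaluation, so calls carry no length proof.
fresh : (l : List Colour) {_ : True (length l ≤? 5)} → ∃ λ k → All (k ≢_) l
fresh l {len} = fresh-≤ l (toWitness len)

unique-or-shorter : ∀ {n} (l : List (Fin n)) → Unique l ⊎ ∃ λ l′ → length l′ < length l × (∀ {k} → k ∈ l → k ∈ l′)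
unique-or-shorter [] = inj₁ []
unique-or-shorter (x ∷ l) with x ∈? l
... | yes x∈l = inj₂ (l , ≤-refl , λ { (here refl) → x∈l ; (there i) → i })
... | no x∉l with unique-or-shorter l
...   | inj₁ u = inj₁ (¬Any⇒All¬ l x∉l ∷ u)
...   | inj₂ (l′ , len , sub) =
  inj₂ (x ∷ l′ , s≤s len , λ { (here e) → here e ; (there i) → there (sub i) })

fresh-or-unique : (l : List Colour) {_ : True (length l ≤? 6)} → (∃ λ k → All (k ≢_) l) ⊎ Unique l
fresh-or-unique l {len} with unique-or-shorter l
... | inj₁ u = inj₂ u
... | inj₂ (l′ , shorter , sub) with fresh-≤ l′ (s≤s⁻¹ (≤-trans shorter (toWitness len)))
...   | k , k∉l′ = inj₁ (k , All.tabulate (λ i → All.lookup k∉l′ (sub i)))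

-- Indices modulo three

rot : Fin 3 → Fin 3
rot zero = suc zero
rot (suc zero) = suc (suc zero)
rot (suc (suc zero)) = zero

rot³ : ∀ i → rot (rot (rot i)) ≡ i
rot³ zero = refl
rot³ (suc zero) = refl
rot³ (suc (suc zero)) = refl

rot-injective : ∀ {i j} → rot i ≡ rot j → i ≡ j
rot-injective {i} {j} e = trans (sym (rot³ i)) (trans (cong (rot ∘ rot) e) (rot³ j))

all₃ : ∀ {P : Fin 3 → Set} → P zero → P (suc zero) → P (suc (suc zero)) → ∀ i → P i
all₃ p q r zero = p
all₃ p q r (suc zero) = q
all₃ p q r (suc (suc zero)) = r

triple : {X : Set} → X → X → X → Fin 3 → X
triple a b c = all₃ a b c

Distinct : {X : Set} {k : ℕ} → (Fin k → X) → Set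
Distinct f = ∀ {i j} → i ≢ j → f i ≢ f j

pair : {X : Set} → X → X → Fin 2 → X
pair a b zero = a
pair a b (suc zero) = b

pair-distinct : {X : Set} {a b : X} → a ≢ b → Distinct (pair a b)
pair-distinct a≢b {zero} {zero} i≢j = contradiction refl i≢j
pair-distinct a≢b {zero} {suc zero} _ = a≢b
pair-distinct a≢b {suc zero} {zero} _ = ≢-sym a≢b
pair-distinct a≢b {suc zero} {suc zero} i≢j = contradiction refl i≢j

triple-distinct : {X : Set} {a b c : X} → a ≢ b → a ≢ c → b ≢ c → Distinct (triple a b c)
triple-distinct a≢b a≢c b≢c {zero} {zero} i≢j = contradiction refl i≢j
triple-distinct a≢b a≢c b≢c {zero} {suc zero} _ = a≢b
triple-distinct a≢b a≢c b≢c {zero} {suc (suc zero)} _ = a≢c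
triple-distinct a≢b a≢c b≢c {suc zero} {zero} _ = ≢-sym a≢b
triple-distinct a≢b a≢c b≢c {suc zero} {suc zero} i≢j = contradiction refl i≢j
triple-distinct a≢b a≢c b≢c {suc zero} {suc (suc zero)} _ = b≢c
triple-distinct a≢b a≢c b≢c {suc (suc zero)} {zero} _ = ≢-sym a≢c
triple-distinct a≢b a≢c b≢c {suc (suc zero)} {suc zero} _ = ≢-sym b≢c
triple-distinct a≢b a≢c b≢c {suc (suc zero)} {suc (suc zero)} i≢j = contradiction refl i≢j

-- Choosing colours for the edges around the deleted row

Palette : Set
Palette = Fin 3 → Colour

infix 4 _∈₂_
_∈₂_ : Colour → Colour × Colour → Set
k ∈₂ (y , z) = k ≡ y ⊎ k ≡ z

_∈₂?_ : ∀ k p → Dec (k ∈₂ p)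
k ∈₂? (y , z) with k ≟ y | k ≟ z
... | yes e | _ = yes (inj₁ e)
... | no _ | yes e = yes (inj₂ e)
... | no n | no m = no [ n , m ]′

-- Candidate colours `o i` for the edges r s_i, once `k` and `m` have been spent on the edges t_i
-- s_i.
Representatives : (k m : Colour) (Y Z : Palette) → Set
Representatives k m Y Z = Σ Palette λ o → Distinct o × (∀ i → All (o i ≢_) (k ∷ m ∷ Y i ∷ Z i ∷ []))

rotate : ∀ {k m Y Z} → Representatives k m Y Z → Representatives k m (Y ∘ rot) (Z ∘ rot)
rotate (o , o-distinct , avoid) = o ∘ rot , (λ i≢j → o-distinct (i≢j ∘ rot-injective)) , avoid ∘ rot

unrotate : ∀ {k m Y Z} → Representatives k m (Y ∘ rot) (Z ∘ rot) → Representatives k m Y Z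
unrotate (o , o-distinct , avoid) =
  o ∘ rot ∘ rot ,
  (λ i≢j → o-distinct (i≢j ∘ rot-injective ∘ rot-injective)) ,
  all₃ (avoid _) (avoid _) (avoid _)

-- Two distinct colours Y 0, Z 0 that occur as {Y i, Z i} for each i: the only case without representatives.
Rigid : (Y Z : Palette) → Set
Rigid Y Z = Y zero ≢ Z zero × (∀ i → Y i ∈₂ (Y (rot i) , Z (rot i)) × Z i ∈₂ (Y (rot i) , Z (rot i)))

-- The colours for the indices 1 and 2 are chosen first. At most five distinct colours are then
-- forbidden at index 0, since its own four contain a repetition.
representatives-repeat : ∀ {k m Y Z} → ¬ Unique (k ∷ m ∷ Y zero ∷ Z zero ∷ []) → Representatives k m Y Z
representatives-repeat {k} {m} {Y} {Z} rep
  with fresh (k ∷ m ∷ Y (suc zero) ∷ Z (suc zero) ∷ [])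
... | b , bk ∷ bm ∷ by ∷ bz ∷ []
  with fresh (k ∷ m ∷ Y (suc (suc zero)) ∷ Z (suc (suc zero)) ∷ b ∷ [])
... | c , ck ∷ cm ∷ cy ∷ cz ∷ cb ∷ []
  with fresh-or-unique (k ∷ m ∷ Y zero ∷ Z zero ∷ b ∷ c ∷ [])
... | inj₁ (a , ak ∷ am ∷ ay ∷ az ∷ ab ∷ ac ∷ []) =
  triple a b c , triple-distinct ab ac (≢-sym cb) ,
  all₃ (ak ∷ am ∷ ay ∷ az ∷ []) (bk ∷ bm ∷ by ∷ bz ∷ []) (ck ∷ cm ∷ cy ∷ cz ∷ [])
... | inj₂ ((km ∷ ky ∷ kz ∷ _) ∷ (my ∷ mz ∷ _) ∷ (yz ∷ _) ∷ _) =
  contradiction ((km ∷ ky ∷ kz ∷ []) ∷ (my ∷ mz ∷ []) ∷ (yz ∷ []) ∷ [] ∷ []) rep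

-- Index 1 takes `z`. This costs index 0 nothing, because `z` is forbidden there already. If `z` is
-- `k` or `m`, the list of index 0 contains a repetition instead.
representatives-differ : ∀ {k m z Y Z} → z ∈₂ (Y zero , Z zero) → ¬ z ∈₂ (Y (suc zero) , Z (suc zero)) →
                         Representatives k m Y Z
representatives-differ {k} {m} {z} {Y} {Z} z∈ z∉ with z ≟ k | z ≟ m
... | yes refl | _ = representatives-repeat λ { ((_ ∷ ky ∷ kz ∷ []) ∷ _) → [ ky , kz ]′ z∈ }
... | no _ | yes refl = representatives-repeat λ { (_ ∷ (my ∷ mz ∷ []) ∷ _) → [ my , mz ]′ z∈ }
... | no z≢k | no z≢m
  with fresh (k ∷ m ∷ Y (suc (suc zero)) ∷ Z (suc (suc zero)) ∷ z ∷ [])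
... | c , ck ∷ cm ∷ cy ∷ cz ∷ c≢z ∷ []
  with fresh (k ∷ m ∷ Y zero ∷ Z zero ∷ c ∷ [])
... | a , ak ∷ am ∷ ay ∷ az ∷ ac ∷ [] =
  triple a z c , triple-distinct a≢z ac (≢-sym c≢z) ,
  all₃ (ak ∷ am ∷ ay ∷ az ∷ []) (z≢k ∷ z≢m ∷ z∉ ∘ inj₁ ∷ z∉ ∘ inj₂ ∷ []) (ck ∷ cm ∷ cy ∷ cz ∷ [])
  where
  a≢z : a ≢ z
  a≢z a≡z = [ (λ e → ay (trans a≡z e)) , (λ e → az (trans a≡z e)) ]′ z∈

one-avoids : ∀ {a b c : Colour} y z → a ≢ b → a ≢ c → b ≢ c →
             ¬ a ∈₂ (y , z) ⊎ ¬ b ∈₂ (y , z) ⊎ ¬ c ∈₂ (y , z)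
one-avoids {a} {b} {c} y z a≢b a≢c b≢c with a ∈₂? (y , z) | b ∈₂? (y , z)
... | no a∉ | _ = inj₁ a∉
... | yes _ | no b∉ = inj₂ (inj₁ b∉)
... | yes (inj₁ refl) | yes (inj₁ refl) = contradiction refl a≢b
... | yes (inj₂ refl) | yes (inj₂ refl) = contradiction refl a≢b
... | yes (inj₁ refl) | yes (inj₂ refl) = inj₂ (inj₂ [ ≢-sym a≢c , ≢-sym b≢c ]′)
... | yes (inj₂ refl) | yes (inj₁ refl) = inj₂ (inj₂ [ ≢-sym b≢c , ≢-sym a≢c ]′)

subset-or-differ : (p q : Colour × Colour) → (proj₁ p ∈₂ q × proj₂ p ∈₂ q) ⊎ (∃ λ z → z ∈₂ p × ¬ z ∈₂ q)
subset-or-differ (y , z) q with y ∈₂? q | z ∈₂? q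
... | no y∉ | _ = inj₂ (y , inj₁ refl , y∉)
... | yes _ | no z∉ = inj₂ (z , inj₂ refl , z∉)
... | yes y∈ | yes z∈ = inj₁ (y∈ , z∈)

-- Around the cycle of indices, either some pair is not contained in the next, which rotates into
-- `representatives-differ`, or all three pairs agree as sets; a pair with `Y zero ≡ Z zero` then
-- falls under `representatives-repeat`.
representatives : ∀ Y Z → Rigid Y Z ⊎ (∀ k m → Representatives k m Y Z)
representatives Y Z
  with subset-or-differ (Y zero , Z zero) (Y (rot zero) , Z (rot zero))
     | subset-or-differ (Y (rot zero) , Z (rot zero)) (Y (rot (rot zero)) , Z (rot (rot zero)))
     | subset-or-differ (Y (rot (rot zero)) , Z (rot (rot zero))) (Y zero , Z zero)
... | inj₂ (_ , z∈ , z∉) | _ | _ = inj₂ λ k m → representatives-differ z∈ z∉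
... | inj₁ _ | inj₂ (_ , z∈ , z∉) | _ = inj₂ λ k m → unrotate (representatives-differ z∈ z∉)
... | inj₁ _ | inj₁ _ | inj₂ (_ , z∈ , z∉) = inj₂ λ k m →
  unrotate {Y = Y} {Z} (unrotate {Y = Y ∘ rot} {Z ∘ rot} (representatives-differ z∈ z∉))
... | inj₁ s₀ | inj₁ s₁ | inj₁ s₂ with Y zero ≟ Z zero
...   | yes Y≡Z = inj₂ λ k m → representatives-repeat λ { (_ ∷ _ ∷ (Y≢Z ∷ []) ∷ _) → Y≢Z Y≡Z }
...   | no Y≢Z = inj₁ (Y≢Z , all₃ s₀ s₁ s₂)

-- Admissible colours for the edges r s_i (o i) and t_i s_i (x i) of the extension step;
-- Y, Z are the colours at t_i and I, J those one step beyond.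
record Assignment {k} (Y Z I J : Fin k → Colour) : Set where
  field
    o x        : Fin k → Colour
    o-distinct : Distinct o
    o≢x        : ∀ i j → o i ≢ x j
    o-avoids   : ∀ i → All (o i ≢_) (Y i ∷ Z i ∷ [])
    x-avoids   : ∀ i → All (x i ≢_) (Y i ∷ Z i ∷ I i ∷ J i ∷ [])

Free : (Y Z I J : Palette) → Fin 3 → Colour → Set
Free Y Z I J i k = All (k ≢_) (Y i ∷ Z i ∷ I i ∷ J i ∷ [])

unrotate-assignment : ∀ {Y Z I J} → Assignment (Y ∘ rot) (Z ∘ rot) (I ∘ rot) (J ∘ rot) → Assignment Y Z I J
unrotate-assignment A = record
  { o = A.o ∘ rot ∘ rot
  ; x = A.x ∘ rot ∘ rot
  ; o-distinct = λ i≢j → A.o-distinct (i≢j ∘ rot-injective ∘ rot-injective)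
  ; o≢x = λ i j → A.o≢x _ _
  ; o-avoids = all₃ (A.o-avoids _) (A.o-avoids _) (A.o-avoids _)
  ; x-avoids = all₃ (A.x-avoids _) (A.x-avoids _) (A.x-avoids _)
  }
  where module A = Assignment A

-- Spending `k` on both t_0 s_0 and t_1 s_1 leaves only two colours in total on the edges t_i s_i,
-- as `Representatives` expects.
assign-common : ∀ {Y Z I J} → (∀ k m → Representatives k m Y Z) →
                (∃ λ k → Free Y Z I J zero k × Free Y Z I J (suc zero) k) → Assignment Y Z I J
assign-common {Y} {Z} {I} {J} rep (k , free₀ , free₁)
  with fresh (Y (suc (suc zero)) ∷ Z (suc (suc zero)) ∷ I (suc (suc zero)) ∷ J (suc (suc zero)) ∷ [])
... | m , free₂ with rep k m
...   | o , o-distinct , avoid = record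
  { o = o
  ; x = triple k k m
  ; o-distinct = o-distinct
  ; o≢x = λ i → case avoid i of λ { (ok ∷ om ∷ _) → all₃ ok ok om }
  ; o-avoids = λ i → case avoid i of λ { (_ ∷ _ ∷ oyz) → oyz }
  ; x-avoids = all₃ free₀ free₁ free₂
  }

free-pair : ∀ Y Z I J i → ∃ λ x → ∃ λ o → Free Y Z I J i x × Free Y Z I J i o × o ≢ x
free-pair Y Z I J i with fresh (Y i ∷ Z i ∷ I i ∷ J i ∷ [])
... | x , x-free with fresh (x ∷ Y i ∷ Z i ∷ I i ∷ J i ∷ [])
...   | o , o≢x ∷ o-free = x , o , x-free , o-free , o≢x

-- Four forbidden colours leave at least two for each index, and disjointness makes the six choices
-- distinct.
assign-disjoint : ∀ {Y Z I J} → (∀ {i j} k → i ≢ j → ¬ (Free Y Z I J i k × Free Y Z I J j k)) →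
                  Assignment Y Z I J
assign-disjoint {Y} {Z} {I} {J} disjoint = record
  { o = o
  ; x = x
  ; o-distinct = λ {i} {j} i≢j e → disjoint (o i) i≢j (o-free i , subst (Free Y Z I J j) (sym e) (o-free j))
  ; o≢x = λ i j → apart i j (i ≟ j)
  ; o-avoids = λ i → case o-free i of λ { (oy ∷ oz ∷ _) → oy ∷ oz ∷ [] }
  ; x-avoids = x-free
  }
  where
  x o : Palette
  x i = proj₁ (free-pair Y Z I J i)
  o i = proj₁ (proj₂ (free-pair Y Z I J i))
  x-free : ∀ i → Free Y Z I J i (x i)
  x-free i = proj₁ (proj₂ (proj₂ (free-pair Y Z I J i)))
  o-free : ∀ i → Free Y Z I J i (o i)
  o-free i = proj₁ (proj₂ (proj₂ (proj₂ (free-pair Y Z I J i))))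
  apart : ∀ i j → Dec (i ≡ j) → o i ≢ x j
  apart i i (yes refl) = proj₂ (proj₂ (proj₂ (proj₂ (free-pair Y Z I J i))))
  apart i j (no i≢j) e = disjoint (o i) i≢j (o-free i , subst (Free Y Z I J j) (sym e) (x-free j))

assign : ∀ Y Z I J → Rigid Y Z ⊎ Assignment Y Z I J
assign Y Z I J with representatives Y Z
... | inj₁ rigid = inj₁ rigid
... | inj₂ rep with common zero (rot zero) | common (rot zero) (rot (rot zero)) | common (rot (rot zero)) zero
  where
  common : ∀ i j → Dec (∃ λ k → Free Y Z I J i k × Free Y Z I J j k)
  common i j = any? λ k → All.all? (λ a → ¬? (k ≟ a)) _ ×-dec All.all? (λ a → ¬? (k ≟ a)) _
...   | yes c | _ | _ = inj₂ (assign-common rep c)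
...   | no _ | yes c | _ = inj₂ (unrotate-assignment (assign-common (λ k m → rotate (rep k m)) c))
...   | no _ | no _ | yes c =
  inj₂ (unrotate-assignment (unrotate-assignment (assign-common (λ k m → rotate (rotate (rep k m))) c)))
...   | no d₀₁ | no d₁₂ | no d₂₀ = inj₂ (assign-disjoint λ k i≢j (f , g) → disjoint k i≢j f g)
  where
  disjoint : ∀ {i j} k → i ≢ j → Free Y Z I J i k → Free Y Z I J j k → ⊥
  disjoint {zero} {zero} k i≢j f g = i≢j refl
  disjoint {zero} {suc zero} k _ f g = d₀₁ (k , f , g)
  disjoint {zero} {suc (suc zero)} k _ f g = d₂₀ (k , g , f)
  disjoint {suc zero} {zero} k _ f g = d₀₁ (k , g , f)
  disjoint {suc zero} {suc zero} k i≢j f g = i≢j refl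
  disjoint {suc zero} {suc (suc zero)} k _ f g = d₁₂ (k , f , g)
  disjoint {suc (suc zero)} {zero} k _ f g = d₂₀ (k , f , g)
  disjoint {suc (suc zero)} {suc zero} k _ f g = d₁₂ (k , g , f)
  disjoint {suc (suc zero)} {suc (suc zero)} k i≢j f g = i≢j refl

-- A greedy choice in the order `x₀`, `x₁`, `o₀`, `o₁` meets at most five forbidden colours each
-- time. Distinct `x` also settle the case of two columns with the same second row.
assign-two : ∀ (Y Z I J : Fin 2 → Colour) → Σ (Assignment Y Z I J) λ A → Distinct (Assignment.x A)
assign-two Y Z I J
  with fresh (Y zero ∷ Z zero ∷ I zero ∷ J zero ∷ [])
... | x₀ , x₀-free
  with fresh (x₀ ∷ Y (suc zero) ∷ Z (suc zero) ∷ I (suc zero) ∷ J (suc zero) ∷ [])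
... | x₁ , x₁≢x₀ ∷ x₁-free
  with fresh (x₀ ∷ x₁ ∷ Y zero ∷ Z zero ∷ [])
... | o₀ , o₀≢x₀ ∷ o₀≢x₁ ∷ o₀-free
  with fresh (x₀ ∷ x₁ ∷ o₀ ∷ Y (suc zero) ∷ Z (suc zero) ∷ [])
... | o₁ , o₁≢x₀ ∷ o₁≢x₁ ∷ o₁≢o₀ ∷ o₁-free = record
  { o = pair o₀ o₁
  ; x = pair x₀ x₁
  ; o-distinct = pair-distinct (≢-sym o₁≢o₀)
  ; o≢x = λ { zero zero → o₀≢x₀ ; zero (suc zero) → o₀≢x₁ ; (suc zero) zero → o₁≢x₀ ; (suc zero) (suc zero) → o₁≢x₁ }
  ; o-avoids = λ { zero → o₀-free ; (suc zero) → o₁-free }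
  ; x-avoids = λ { zero → x₀-free ; (suc zero) → x₁-free }
  } , pair-distinct (≢-sym x₁≢x₀)

-- For t_0 = t_1: one colour `y` remains at that row and one colour `i` beyond it, while `x zero`
-- and the next `x` must differ. Of two colours free at index 2, one is reused at index 0, unless
-- both lie in `y`, `i`; then index 2 takes `y` for its `x` and `i` for its `o`.
assign-shared : ∀ y i Y Z I J →
                Σ (Assignment (triple y y Y) (triple y y Z) (triple i i I) (triple i i J)) λ A →
                Assignment.x A zero ≢ Assignment.x A (suc zero)
assign-shared y i Y Z I J with fresh (Y ∷ Z ∷ I ∷ J ∷ [])
... | m , m-free@(mY ∷ mZ ∷ _) with fresh (m ∷ Y ∷ Z ∷ I ∷ J ∷ [])
...   | l , l≢m ∷ l-free@(lY ∷ lZ ∷ _) = choose (m ∈₂? (y , i)) (l ∈₂? (y , i))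
  where
  Goal : Set
  Goal = Σ (Assignment (triple y y Y) (triple y y Z) (triple i i I) (triple i i J)) λ A →
         Assignment.x A zero ≢ Assignment.x A (suc zero)

  reuse : ∀ {k} → All (k ≢_) (Y ∷ Z ∷ I ∷ J ∷ []) → ¬ k ∈₂ (y , i) → Goal
  reuse {k} k-free k∉
    with fresh (k ∷ y ∷ i ∷ [])
  ... | x₁ , x₁≢k ∷ x₁y ∷ x₁i ∷ []
    with fresh (k ∷ x₁ ∷ Y ∷ Z ∷ [])
  ... | o₂ , o₂k ∷ o₂x₁ ∷ o₂-free
    with fresh (k ∷ x₁ ∷ y ∷ o₂ ∷ [])
  ... | o₀ , o₀k ∷ o₀x₁ ∷ o₀y ∷ o₀o₂ ∷ []
    with fresh (k ∷ x₁ ∷ y ∷ o₂ ∷ o₀ ∷ [])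
  ... | o₁ , o₁k ∷ o₁x₁ ∷ o₁y ∷ o₁o₂ ∷ o₁o₀ ∷ [] = record
    { o = triple o₀ o₁ o₂
    ; x = triple k x₁ k
    ; o-distinct = triple-distinct (≢-sym o₁o₀) o₀o₂ o₁o₂
    ; o≢x = all₃ (all₃ o₀k o₀x₁ o₀k) (all₃ o₁k o₁x₁ o₁k) (all₃ o₂k o₂x₁ o₂k)
    ; o-avoids = all₃ (o₀y ∷ o₀y ∷ []) (o₁y ∷ o₁y ∷ []) o₂-free
    ; x-avoids = all₃ (ky ∷ ky ∷ ki ∷ ki ∷ []) (x₁y ∷ x₁y ∷ x₁i ∷ x₁i ∷ []) k-free
    } , ≢-sym x₁≢k
    where
    ky = k∉ ∘ inj₁
    ki = k∉ ∘ inj₂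

  cross : All (y ≢_) (Y ∷ Z ∷ I ∷ J ∷ []) → i ≢ y → i ≢ Y → i ≢ Z → Goal
  cross y-free iy iY iZ
    with fresh (y ∷ i ∷ [])
  ... | x₀ , x₀y ∷ x₀i ∷ []
    with fresh (y ∷ i ∷ x₀ ∷ [])
  ... | x₁ , x₁y ∷ x₁i ∷ x₁x₀ ∷ []
    with fresh (x₀ ∷ x₁ ∷ y ∷ i ∷ [])
  ... | o₀ , o₀x₀ ∷ o₀x₁ ∷ o₀y ∷ o₀i ∷ []
    with fresh (x₀ ∷ x₁ ∷ y ∷ i ∷ o₀ ∷ [])
  ... | o₁ , o₁x₀ ∷ o₁x₁ ∷ o₁y ∷ o₁i ∷ o₁o₀ ∷ [] = record
    { o = triple o₀ o₁ i
    ; x = triple x₀ x₁ y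
    ; o-distinct = triple-distinct (≢-sym o₁o₀) o₀i o₁i
    ; o≢x = all₃ (all₃ o₀x₀ o₀x₁ o₀y) (all₃ o₁x₀ o₁x₁ o₁y) (all₃ (≢-sym x₀i) (≢-sym x₁i) iy)
    ; o-avoids = all₃ (o₀y ∷ o₀y ∷ []) (o₁y ∷ o₁y ∷ []) (iY ∷ iZ ∷ [])
    ; x-avoids = all₃ (x₀y ∷ x₀y ∷ x₀i ∷ x₀i ∷ []) (x₁y ∷ x₁y ∷ x₁i ∷ x₁i ∷ []) y-free
    } , ≢-sym x₁x₀

  choose : Dec (m ∈₂ (y , i)) → Dec (l ∈₂ (y , i)) → Goal
  choose (no m∉) _ = reuse m-free m∉
  choose (yes _) (no l∉) = reuse l-free l∉
  choose (yes (inj₁ refl)) (yes (inj₁ refl)) = contradiction refl l≢m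
  choose (yes (inj₁ refl)) (yes (inj₂ refl)) = cross m-free l≢m lY lZ
  choose (yes (inj₂ refl)) (yes (inj₁ refl)) = cross l-free (≢-sym l≢m) mY mZ
  choose (yes (inj₂ refl)) (yes (inj₂ refl)) = contradiction refl l≢m

-- Strong colourings of row-column relations

module _ {n : ℕ} where

  Edges : Set₁
  Edges = Fin n → Fin n → Set

  Colouring : Set
  Colouring = Fin n × Fin n → Colour

  infix 4 _≟ₑ_
  _≟ₑ_ : DecidableEquality (Fin n × Fin n)
  _≟ₑ_ = ≡-dec _≟_ _≟_

  -- E a b is an edge between the row a and the column b, so two edges (a , b) and (a′ , b′) are close
  -- precisely when E a b′ or E a′ b; a common endpoint is a special case.
  Conflict : Edges → Fin n × Fin n → Fin n × Fin n → Set
  Conflict E (a , b) (a′ , b′) = E a b × E a′ b′ × (E a b′ ⊎ E a′ b) × (a , b) ≢ (a′ , b′)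

  conflict-sym : ∀ {E e f} → Conflict E e f → Conflict E f e
  conflict-sym (e , f , inj₁ j , e≢f) = f , e , inj₂ j , ≢-sym e≢f
  conflict-sym (e , f , inj₂ j , e≢f) = f , e , inj₁ j , ≢-sym e≢f

  Proper : Edges → Colouring → Set
  Proper E c = ∀ {e f} → Conflict E e f → c e ≢ c f

  Colourable : Edges → Set
  Colourable E = Σ Colouring (Proper E)

  record Sparse (E : Edges) : Set where
    field
      rows  : ∀ a → AtMost 3 (E a)
      cols  : ∀ b → AtMost 3 (flip E b)
      ends  : ∀ {a b} → E a b → AtMost 2 (E a) ⊎ AtMost 2 (flip E b)

  sparse-⊆ : ∀ {E F : Edges} → (∀ {a b} → F a b → E a b) → Sparse E → Sparse F
  sparse-⊆ F⊆E sparse = record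
    { rows = λ a → atMost-⊆ F⊆E (rows a)
    ; cols = λ b → atMost-⊆ F⊆E (cols b)
    ; ends = λ f → [ inj₁ ∘ atMost-⊆ F⊆E , inj₂ ∘ atMost-⊆ F⊆E ]′ (ends (F⊆E f))
    }
    where open Sparse sparse

  -- Exchanging the two edges exchanges the two ways of being joined, so one of them suffices.
  proper-by : ∀ {E c} → (∀ {a b a′ b′} → E a b → E a′ b′ → E a b′ → (a , b) ≢ (a′ , b′) → c (a , b) ≢ c (a′ , b′)) →
              Proper E c
  proper-by half (e , f , inj₁ j , e≢f) = half e f j e≢f
  proper-by half (e , f , inj₂ j , e≢f) = ≢-sym (half f e j (≢-sym e≢f))

  update : Fin n × Fin n → Colour → Colouring → Colouring
  update v p c e with e ≟ₑ v
  ... | yes _ = p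
  ... | no _ = c e

  update-≡ : ∀ v p c → update v p c v ≡ p
  update-≡ v p c with v ≟ₑ v
  ... | yes _ = refl
  ... | no v≢v = contradiction refl v≢v

  update-≢ : ∀ {v p c e} → e ≢ v → update v p c e ≡ c e
  update-≢ {v} {e = e} e≢v with e ≟ₑ v
  ... | yes e≡v = contradiction e≡v e≢v
  ... | no _ = refl

  proper-update : ∀ {E c v p} → Proper E c → (∀ {f} → Conflict E v f → p ≢ c f) → Proper E (update v p c)
  proper-update {v = v} proper avoid {e} {f} cf with e ≟ₑ v | f ≟ₑ v
  ... | yes refl | yes refl = contradiction refl (proj₂ (proj₂ (proj₂ cf)))
  ... | yes refl | no _ = avoid cf
  ... | no _ | yes refl = ≢-sym (avoid (conflict-sym cf))
  ... | no _ | no _ = proper cf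

  -- Each new colour is compared with the old colouring only away from the other changed edge, so
  -- the two edges may exchange or hand on colours.
  proper-update₂ : ∀ {E c v w p m} → Proper E c → p ≢ m →
                   (∀ {f} → Conflict E v f → f ≢ w → p ≢ c f) → (∀ {f} → Conflict E w f → f ≢ v → m ≢ c f) →
                   Proper E (update v p (update w m c))
  proper-update₂ {v = v} {w} proper p≢m avoid-v avoid-w {e} {f} cf with e ≟ₑ v | f ≟ₑ v
  ... | yes refl | yes refl = contradiction refl (proj₂ (proj₂ (proj₂ cf)))
  ... | yes refl | no _ with f ≟ₑ w
  ...   | yes refl = p≢m
  ...   | no f≢w = avoid-v cf f≢w
  proper-update₂ {v = v} {w} proper p≢m avoid-v avoid-w {e} {f} cf | no _ | yes refl with e ≟ₑ w
  ...   | yes refl = ≢-sym p≢m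
  ...   | no e≢w = ≢-sym (avoid-v (conflict-sym cf) e≢w)
  proper-update₂ {v = v} {w} proper p≢m avoid-v avoid-w {e} {f} cf | no e≢v | no f≢v with e ≟ₑ w | f ≟ₑ w
  ...   | yes refl | yes refl = contradiction refl (proj₂ (proj₂ (proj₂ cf)))
  ...   | yes refl | no _ = avoid-w cf f≢v
  ...   | no _ | yes refl = ≢-sym (avoid-w (conflict-sym cf) e≢v)
  ...   | no _ | no _ = proper cf

  -- Recolouring near a row with two columns

  module _ {E : Edges} (E? : ∀ a b → Dec (E a b)) (sparse : Sparse E) where
    open Sparse sparse

    -- If some edge at `a` yields the bound on the row, that bound answers for all; otherwise each
    -- edge yields the bound on its column.
    thin-row-or-cols : ∀ a → AtMost 2 (E a) ⊎ (∀ b → E a b → AtMost 2 (flip E b))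
    thin-row-or-cols a = search decide
      where
      decide : ∀ b → AtMost 2 (E a) ⊎ (E a b → AtMost 2 (flip E b))
      decide b with E? a b
      ... | no ¬e = inj₂ λ e → contradiction e ¬e
      ... | yes e = [ inj₁ , (λ m → inj₂ λ _ → m) ]′ (ends e)

    -- Either `t` has at most one further column, with at most two further rows, or at most two
    -- further columns, each with at most one further row: 1 · 2 or 2 · 1 edges.
    beyond : ∀ {t s} → E t s →
             AtMost 2 λ ((a , b) : Fin n × Fin n) → (E t b × b ≢ s) × (E a b × a ≢ t)
    beyond {t} {s} e with thin-row-or-cols t
    ... | inj₁ thin =
      let l , len , cover = atMost-Σ (λ b → E? t b ×-dec ¬? (b ≟ s)) (atMost-remove _≟_ e thin)
                                     (λ {b} (eb , _) → atMost-remove _≟_ eb (cols b))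
      in l , len , λ (q , p) → cover q p
    ... | inj₂ thin =
      let l , len , cover = atMost-Σ (λ b → E? t b ×-dec ¬? (b ≟ s)) (atMost-remove _≟_ e (rows t))
                                     (λ {b} (eb , _) → atMost-remove _≟_ eb (thin b eb))
      in l , len , λ (q , p) → cover q p

    beyond-dec : ∀ t s ((a , b) : Fin n × Fin n) → Dec ((E t b × b ≢ s) × (E a b × a ≢ t))
    beyond-dec t s (a , b) = (E? t b ×-dec ¬? (b ≟ s)) ×-dec (E? a b ×-dec ¬? (a ≟ t))

    -- Stability keeps the edges outside row `t` that carry one of the two old colours, hence all
    -- the colours at another row showing the same pair. The colour `z` shows that the pair at `t`
    -- has changed as a set.
    Recolouring : Colouring → Fin n → Fin n → Fin n → Set
    Recolouring c t q q′ = ∃ λ c′ → Proper E c′ ×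
      (∀ {a b} → a ≢ t → c (a , b) ∈₂ (c (t , q) , c (t , q′)) → c′ (a , b) ≡ c (a , b)) ×
      (∃ λ z → z ∈₂ (c′ (t , q) , c′ (t , q′)) × ¬ z ∈₂ (c (t , q) , c (t , q′)))

    recolouring-swap : ∀ {c t q q′} → Recolouring c t q′ q → Recolouring c t q q′
    recolouring-swap (c′ , proper , stable , z , z∈ , z∉) =
      c′ , proper , (λ a≢t → stable a≢t ∘ Sum.swap) , z , Sum.swap z∈ , z∉ ∘ Sum.swap

    module Fork (c : Colouring) (proper : Proper E c) (t q q′ : Fin n) (tq : E t q) (tq′ : E t q′)
                (q≢q′ : q ≢ q′) (fork : ∀ {b} → E t b → b ≡ q ⊎ b ≡ q′) where

      Others : Fin n → Fin n → Set
      Others s a = E a s × a ≢ t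

      others? : ∀ s a → Dec (Others s a)
      others? s a = E? a s ×-dec ¬? (a ≟ t)

      data Near : Fin n × Fin n → Set where
        at-t     : Near (t , q′)
        in-q     : ∀ {a} → Others q a → Near (a , q)
        in-q′    : ∀ {a} → Others q′ a → Near (a , q′)
        past-q   : ∀ {a b} → Others q a → E a b → b ≢ q → Near (a , b)

      -- A joined edge has its column at `t`, so that column is `q` or `q′`, or it has its row at
      -- `q`.
      near : ∀ {f} → Conflict E (t , q) f → Near f
      near {a , b} (_ , ab , join , e≢f) with a ≟ t | b ≟ q
      ... | yes refl | yes refl = contradiction refl e≢f
      ... | yes refl | no b≢q with fork ab
      ...   | inj₁ b≡q = contradiction b≡q b≢q
      ...   | inj₂ refl = at-t
      near {a , b} (_ , ab , join , e≢f) | no a≢t | yes refl = in-q (ab , a≢t)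
      near {a , b} (_ , ab , inj₂ aq , e≢f) | no a≢t | no b≢q = past-q (aq , a≢t) ab b≢q
      near {a , b} (_ , ab , inj₁ tb , e≢f) | no a≢t | no b≢q with fork tb
      ...   | inj₁ b≡q = contradiction b≡q b≢q
      ...   | inj₂ refl = in-q′ (ab , a≢t)

      -- The new colour serves as `z`: it differs from that of `(t , q′)` because this edge is in
      -- conflict with `(t , q)`.
      recolour-one : ∀ {k} → k ≢ c (t , q) → (∀ {f} → Conflict E (t , q) f → k ≢ c f) → Recolouring c t q q′
      recolour-one {k} k≢c avoid =
        update (t , q) k c , proper-update {c = c} proper avoid ,
        (λ a≢t _ → update-≢ (a≢t ∘ cong proj₁)) ,
        k , inj₁ (sym (update-≡ (t , q) k c)) ,
        [ k≢c , avoid (tq , tq′ , inj₁ tq′ , q≢q′ ∘ cong proj₂) ]′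

      -- When `t` is the only row at `q`, the edge `(t , q)` conflicts with `(t , q′)` and at most
      -- one further edge at `q′`, so a new colour is at hand.
      recolour-dangling : AtMost 1 (Others q′) → (∀ a → ¬ Others q a) → Recolouring c t q q′
      recolour-dangling thin′ none with atMost₁ (others? q′) thin′
      ... | inj₁ none′ with fresh (c (t , q) ∷ c (t , q′) ∷ [])
      ...   | k , kc ∷ kd ∷ [] = recolour-one kc (avoid ∘ near)
        where
        avoid : ∀ {f} → Near f → k ≢ c f
        avoid at-t = kd
        avoid (in-q o) = contradiction o (none _)
        avoid (in-q′ o) = contradiction o (none′ _)
        avoid (past-q o _ _) = contradiction o (none _)
      recolour-dangling thin′ none | inj₂ (u′ , _ , only′) with fresh (c (t , q) ∷ c (t , q′) ∷ c (u′ , q′) ∷ [])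
      ...   | k , kc ∷ kd ∷ kf ∷ [] = recolour-one kc (avoid ∘ near)
        where
        avoid : ∀ {f} → Near f → k ≢ c f
        avoid at-t = kd
        avoid (in-q o) = contradiction o (none _)
        avoid (in-q′ o) e = kf (trans e (cong (λ a → c (a , q′)) (only′ o)))
        avoid (past-q o _ _) = contradiction o (none _)

      module Tail (u u′ w w′ : Fin n)
                  (only : ∀ {a} → Others q a → a ≡ u) (only′ : ∀ {a} → Others q′ a → a ≡ u′)
                  (rest : ∀ {b} → E u b × b ≢ q → b ≡ w ⊎ b ≡ w′) where

        surroundings : List (Fin n × Fin n)
        surroundings = (t , q′) ∷ (u , q) ∷ (u′ , q′) ∷ (u , w) ∷ (u , w′) ∷ []

        surround : ∀ {f} → Conflict E (t , q) f → f ∈ surroundings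
        surround cf with near cf
        ... | at-t = here refl
        ... | in-q o = there (here (cong (_, q) (only o)))
        ... | in-q′ o = there (there (here (cong (_, q′) (only′ o))))
        ... | past-q o ab b≢q with refl ← only o | rest (ab , b≢q)
        ...   | inj₁ refl = there (there (there (here refl)))
        ...   | inj₂ refl = there (there (there (there (here refl))))

        -- With `(t , q)` itself there are six edges, and any repeated colour frees one for
        -- `(t , q)`. Degenerate positions such as `u ≡ u′` or `w ≡ w′` list an edge twice, so they
        -- end in the first alternative.
        one-or-unique : Recolouring c t q q′ ⊎ Unique (c (t , q) ∷ map c surroundings)
        one-or-unique with fresh-or-unique (c (t , q) ∷ map c surroundings)
        ... | inj₂ unique = inj₂ unique
        ... | inj₁ (k , k≢c ∷ k∉) = inj₁ (recolour-one k≢c λ cf → All.lookup k∉ (∈-map⁺ c (surround cf)))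

        -- The only row at `q` besides `u` is `t`, with just the two edges of the fork; all other
        -- conflicts run through a further column of `u`.
        tail-surround : ∀ {f} → Conflict E (u , q) f →
                        f ∈ (t , q) ∷ (t , q′) ∷ (u , w) ∷ (u , w′) ∷ [] ⊎
                        (E u (proj₂ f) × proj₂ f ≢ q) × (E (proj₁ f) (proj₂ f) × proj₁ f ≢ u)
        tail-surround {a , b} (_ , ab , join , e≢f) with a ≟ u | b ≟ q
        ... | yes refl | yes refl = contradiction refl e≢f
        ... | yes refl | no b≢q with rest (ab , b≢q)
        ...   | inj₁ refl = inj₁ (there (there (here refl)))
        ...   | inj₂ refl = inj₁ (there (there (there (here refl))))
        tail-surround {a , b} (_ , ab , join , e≢f) | no a≢u | yes refl with a ≟ t
        ...   | yes refl = inj₁ (here refl)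
        ...   | no a≢t = contradiction (only (ab , a≢t)) a≢u
        tail-surround {a , b} (_ , ab , inj₁ ub , e≢f) | no a≢u | no b≢q = inj₂ ((ub , b≢q) , (ab , a≢u))
        tail-surround {a , b} (_ , ab , inj₂ aq , e≢f) | no a≢u | no b≢q with a ≟ t
        ... | no a≢t = contradiction (only (aq , a≢t)) a≢u
        ... | yes refl with fork ab
        ...   | inj₁ b≡q = contradiction b≡q b≢q
        ...   | inj₂ refl = inj₁ (there (here refl))

      -- Stability holds because `w` lies in row `t` and the old colour of `v` is outside the pair;
      -- `m` is the colour gained.
      recolour-two : ∀ {p m v w} → v ≢ w → w ≡ (t , q) ⊎ w ≡ (t , q′) →
                     ¬ c v ∈₂ (c (t , q) , c (t , q′)) → ¬ m ∈₂ (c (t , q) , c (t , q′)) →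
                     Proper E (update v p (update w m c)) → Recolouring c t q q′
      recolour-two {p} {m} {v} {w} v≢w w∈ cv∉ m∉ proper′ =
        update v p (update w m c) , proper′ ,
        (λ a≢t c∈ → trans (update-≢ λ e → cv∉ (subst (λ f → c f ∈₂ _) e c∈))
                          (update-≢ λ e → a≢t (trans (cong proj₁ e) w₁))) ,
        m , at w∈ , m∉
        where
        w₁ : proj₁ w ≡ t
        w₁ = [ cong proj₁ , cong proj₁ ]′ w∈
        new : m ≡ update v p (update w m c) w
        new = sym (trans (update-≢ (≢-sym v≢w)) (update-≡ w m c))
        at : w ≡ (t , q) ⊎ w ≡ (t , q′) →
             m ∈₂ (update v p (update w m c) (t , q) , update v p (update w m c) (t , q′))
        at (inj₁ refl) = inj₁ new
        at (inj₂ refl) = inj₂ new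

    module Knot (c : Colouring) (proper : Proper E c) (t q q′ : Fin n) (tq : E t q) (tq′ : E t q′)
                (q≢q′ : q ≢ q′) (fork : ∀ {b} → E t b → b ≡ q ⊎ b ≡ q′)
                (u u′ : Fin n) (uq : E u q) (u≢t : u ≢ t) (uq′ : E u′ q′)
                (only : ∀ {a} → E a q × a ≢ t → a ≡ u) (only′ : ∀ {a} → E a q′ × a ≢ t → a ≡ u′) where

      module F = Fork c proper t q q′ tq tq′ q≢q′ fork
      module F′ = Fork c proper t q′ q tq′ tq (≢-sym q≢q′) (Sum.swap ∘ fork)

      -- When neither edge at t can be recoloured alone, the colours c, d, e, f of (t , q), (t , q′),
      -- (u , q), (u′ , q′) and the two at u are all six. Beyond u only two colours occur, so one
      -- of c, d, f is available for (u , q), and its old colour e for one of the edges at t.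
      untie : Recolouring c t q q′
      untie
        with atMost₂ q (λ b → E? u b ×-dec ¬? (b ≟ q)) (atMost-remove _≟_ uq (rows u))
           | atMost₂ q′ (λ b → E? u′ b ×-dec ¬? (b ≟ q′)) (atMost-remove _≟_ uq′ (rows u′))
           | atMost₂ (t , q) (beyond-dec u q) (beyond uq)
      ... | w , w′ , rest , _ | v , v′ , rest′ , _ | j , j′ , ahead , _
        with F.Tail.one-or-unique u u′ w w′ only only′ rest | F′.Tail.one-or-unique u′ u v v′ only′ only rest′
      ... | inj₁ done | _ = done
      ... | inj₂ _ | inj₁ done = recolouring-swap done
      ... | inj₂ ((cd ∷ ce ∷ cf ∷ cw ∷ cw′ ∷ []) ∷ (de ∷ df ∷ dw ∷ dw′ ∷ []) ∷ (ef ∷ ew ∷ ew′ ∷ []) ∷ (fw ∷ fw′ ∷ []) ∷ _)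
          | inj₂ (_ ∷ _ ∷ _ ∷ (ev ∷ ev′ ∷ []) ∷ _)
        = choose (one-avoids (c j) (c j′) cd cf df)
        where
        module T = F.Tail u u′ w w′ only only′ rest
        module T′ = F′.Tail u′ u v v′ only′ only rest′

        e∉ : ¬ c (u , q) ∈₂ (c (t , q) , c (t , q′))
        e∉ = [ ≢-sym ce , ≢-sym de ]′

        ahead-avoids : ∀ {p f} → ¬ p ∈₂ (c j , c j′) →
                       (E u (proj₂ f) × proj₂ f ≢ q) × (E (proj₁ f) (proj₂ f) × proj₁ f ≢ u) → p ≢ c f
        ahead-avoids p∉ h p≡ with ahead h
        ... | inj₁ refl = p∉ (inj₁ p≡)
        ... | inj₂ refl = p∉ (inj₂ p≡)

        swap-q : ∀ {p} → p ≢ c (t , q′) → p ≢ c (u , q) → p ≢ c (u , w) → p ≢ c (u , w′) → ¬ p ∈₂ (c j , c j′) →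
                 Recolouring c t q q′
        swap-q {p} pd pe pw pw′ p∉ =
          F.recolour-two (u≢t ∘ cong proj₁) (inj₁ refl) e∉ e∉ (proper-update₂ {c = c} proper pe tail root)
          where
          tail : ∀ {f} → Conflict E (u , q) f → f ≢ (t , q) → p ≢ c f
          tail cf f≢ with T.tail-surround cf
          ... | inj₁ (here refl) = contradiction refl f≢
          ... | inj₁ (there (here refl)) = pd
          ... | inj₁ (there (there (here refl))) = pw
          ... | inj₁ (there (there (there (here refl)))) = pw′
          ... | inj₂ h = ahead-avoids p∉ h
          root : ∀ {f} → Conflict E (t , q) f → f ≢ (u , q) → c (u , q) ≢ c f
          root cf f≢ with T.surround cf
          ... | here refl = ≢-sym de
          ... | there (here refl) = contradiction refl f≢
          ... | there (there (here refl)) = ef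
          ... | there (there (there (here refl))) = ew
          ... | there (there (there (there (here refl)))) = ew′

        swap-q′ : ¬ c (t , q′) ∈₂ (c j , c j′) → Recolouring c t q q′
        swap-q′ d∉ =
          F.recolour-two (u≢t ∘ cong proj₁) (inj₂ refl) e∉ e∉ (proper-update₂ {c = c} proper de tail root)
          where
          tail : ∀ {f} → Conflict E (u , q) f → f ≢ (t , q′) → c (t , q′) ≢ c f
          tail cf f≢ with T.tail-surround cf
          ... | inj₁ (here refl) = ≢-sym cd
          ... | inj₁ (there (here refl)) = contradiction refl f≢
          ... | inj₁ (there (there (here refl))) = dw
          ... | inj₁ (there (there (there (here refl)))) = dw′
          ... | inj₂ h = ahead-avoids d∉ h
          root : ∀ {f} → Conflict E (t , q′) f → f ≢ (u , q) → c (u , q) ≢ c f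
          root cf f≢ with T′.surround cf
          ... | here refl = ≢-sym ce
          ... | there (here refl) = ef
          ... | there (there (here refl)) = contradiction refl f≢
          ... | there (there (there (here refl))) = ev
          ... | there (there (there (there (here refl)))) = ev′

        choose : ¬ c (t , q) ∈₂ (c j , c j′) ⊎ ¬ c (t , q′) ∈₂ (c j , c j′) ⊎ ¬ c (u′ , q′) ∈₂ (c j , c j′) → Recolouring c t q q′
        choose (inj₁ c∉) = swap-q cd ce cw cw′ c∉
        choose (inj₂ (inj₁ d∉)) = swap-q′ d∉
        -- No exchange here: `(u , q)` copies the colour of `(u′ , q′)`, which keeps it.
        choose (inj₂ (inj₂ f∉)) = swap-q (≢-sym df) (≢-sym ef) fw fw′ f∉

    recolour : ∀ {c t q q′} → Proper E c → E t q → E t q′ → q ≢ q′ → (∀ {b} → E t b → b ≡ q ⊎ b ≡ q′) →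
               AtMost 2 (flip E q) → AtMost 2 (flip E q′) → Recolouring c t q q′
    recolour {c} {t} {q} {q′} proper tq tq′ q≢q′ fork thin thin′
      with atMost₁ (λ a → E? a q ×-dec ¬? (a ≟ t)) (atMost-remove _≟_ tq thin)
         | atMost₁ (λ a → E? a q′ ×-dec ¬? (a ≟ t)) (atMost-remove _≟_ tq′ thin′)
    ... | inj₁ none | _ =
      Fork.recolour-dangling c proper t q q′ tq tq′ q≢q′ fork (atMost-remove _≟_ tq′ thin′) none
    ... | inj₂ _ | inj₁ none′ =
      recolouring-swap (Fork.recolour-dangling c proper t q′ q tq′ tq (≢-sym q≢q′) (Sum.swap ∘ fork)
                                               (atMost-remove _≟_ tq thin) none′)
    ... | inj₂ (u , (uq , u≢t) , only) | inj₂ (u′ , (uq′ , _) , only′) =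
      Knot.untie c proper t q q′ tq tq′ q≢q′ fork u u′ uq u≢t uq′ only only′

  -- Extending a colouring over a reducible row

  module Step {E : Edges} (E? : ∀ a b → Dec (E a b)) (sparse : Sparse E) (r : Fin n)
              (thin : ∀ {b} → E r b → AtMost 2 (flip E b)) where
    open Sparse sparse

    -- Whole columns are deleted, so the edges t_i s_i go as well and row `r` becomes empty.
    F : Edges
    F a b = E a b × ¬ E r b

    F? : ∀ a b → Dec (F a b)
    F? a b = E? a b ×-dec ¬? (E? r b)

    F-row≢r : ∀ {a b} → F a b → a ≢ r
    F-row≢r (e , ¬e) refl = ¬e e

    other-row-unique : ∀ {a a′ s} → E r s → a ≢ r → a′ ≢ r → E a s → E a′ s → a ≡ a′
    other-row-unique {a} {a′} rs a≢r a′≢r as a′s with a ≟ a′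
    ... | yes e = e
    ... | no a≢a′ = contradiction (≢-sym a≢a′) (atMost₂-overfull _≟_ (thin rs) rs as a′s a≢r a′≢r)

    -- No old edge has its column at `r`. Hence it conflicts with r s_i only when its row is t_i,
    -- and with t_i s_i only when its row is t_i or its column is at t_i; these are the colours
    -- bounded by `Y`, `Z` and `I`, `J`.
    extend : ∀ {k c} {s : Fin k → Fin n} {Y Z I J} →
             (∀ {b} → E r b → ∃ λ i → b ≡ s i) → Proper F c →
             (∀ {i a b} → E a (s i) → F a b → c (a , b) ∈₂ (Y i , Z i)) →
             (∀ {i a a′ b} → E a (s i) → F a b → F a′ b → a′ ≢ a → c (a′ , b) ∈₂ (I i , J i)) →
             (A : Assignment Y Z I J) →
             (∀ {i j a} → i ≢ j → a ≢ r → E a (s i) → E a (s j) → Assignment.x A i ≢ Assignment.x A j) →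
             Colourable E
    extend {k} {c} {s} cover proper near far A x-shared = paint , proper-by half
      where
      open Assignment A

      near-o : ∀ {i a b} → E a (s i) → F a b → o i ≢ c (a , b)
      near-o {i} as ab e with o-avoids i | near as ab
      ... | oy ∷ oz ∷ [] | inj₁ ≡y = oy (trans e ≡y)
      ... | oy ∷ oz ∷ [] | inj₂ ≡z = oz (trans e ≡z)

      far-x : ∀ {i a a′ b} → E a (s i) → F a b → F a′ b → x i ≢ c (a′ , b)
      far-x {i} {a} {a′} as ab a′b e with a′ ≟ a | x-avoids i
      ... | no a′≢a | _ ∷ _ ∷ xi ∷ xj ∷ [] = [ (λ ≡i → xi (trans e ≡i)) , (λ ≡j → xj (trans e ≡j)) ]′ (far as ab a′b a′≢a)
      ... | yes refl | xy ∷ xz ∷ _ = [ (λ ≡y → xy (trans e ≡y)) , (λ ≡z → xz (trans e ≡z)) ]′ (near as ab)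

      paint : Colouring
      paint (a , b) with E? r b | a ≟ r
      ... | yes e | yes _ = o (proj₁ (cover e))
      ... | yes e | no _ = x (proj₁ (cover e))
      ... | no _ | _ = c (a , b)

      half : ∀ {a b a′ b′} → E a b → E a′ b′ → E a b′ → (a , b) ≢ (a′ , b′) → paint (a , b) ≢ paint (a′ , b′)
      half {a} {b} {a′} {b′} ab a′b′ ab′ e≢f with E? r b | a ≟ r | E? r b′ | a′ ≟ r
      ... | yes e | yes refl | yes e′ | yes refl with cover e | cover e′
      ...   | i , refl | j , refl = o-distinct λ { refl → e≢f refl }
      half ab a′b′ ab′ e≢f | yes e | yes refl | yes e′ | no _ = o≢x _ _
      half ab a′b′ ab′ e≢f | yes e | no _ | yes e′ | yes refl = ≢-sym (o≢x _ _)
      -- Both rows are the second row of column `b′`, hence equal: two edges t_i s_i conflict only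
      -- at a common row.
      half ab a′b′ ab′ e≢f | yes e | no a≢r | yes e′ | no a′≢r
        with cover e | cover e′ | other-row-unique e′ a≢r a′≢r ab′ a′b′
      ...   | i , refl | j , refl | refl = x-shared (λ { refl → e≢f refl }) a≢r ab ab′
      half ab a′b′ ab′ e≢f | yes e | yes refl | no ¬e′ | _ = contradiction ab′ ¬e′
      half ab a′b′ ab′ e≢f | yes e | no _ | no ¬e′ | _ with cover e
      ...   | i , refl = far-x ab (ab′ , ¬e′) (a′b′ , ¬e′)
      half ab a′b′ ab′ e≢f | no ¬e | _ | yes e′ | yes refl with cover e′
      ...   | j , refl = ≢-sym (near-o ab′ (ab , ¬e))
      half ab a′b′ ab′ e≢f | no ¬e | _ | yes e′ | no a′≢r
        with cover e′ | other-row-unique e′ (λ { refl → ¬e ab }) a′≢r ab′ a′b′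
      ...   | j , refl | refl = ≢-sym (far-x ab′ (ab , ¬e) (ab , ¬e))
      half ab a′b′ ab′ e≢f | no ¬e | _ | no ¬e′ | _ =
        proper ((ab , ¬e) , (a′b′ , ¬e′) , inj₁ (ab′ , ¬e′) , e≢f)

    -- t is the row of s other than r, and r itself if there is none.
    record Slot (s : Fin n) : Set where
      field
        t q q′ : Fin n
        i i′   : Fin n × Fin n
        lone   : ∀ {a} → a ≢ r → E a s → a ≡ t
        root   : t ≢ r → E t s
        fork   : ∀ {b} → F t b → b ≡ q ⊎ b ≡ q′
        tight  : q ≢ q′ → F t q × F t q′ × AtMost 2 (flip F q) × AtMost 2 (flip F q′)
        ahead  : ∀ {a b} → F t b → F a b → a ≢ t → (a , b) ≡ i ⊎ (a , b) ≡ i′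

      near : ∀ (c : Colouring) {a b} → E a s → F a b → c (a , b) ∈₂ (c (t , q) , c (t , q′))
      near c as ab with refl ← lone (F-row≢r ab) as = Sum.map (cong (λ b → c (_ , b))) (cong (λ b → c (_ , b))) (fork ab)

      far : ∀ (c : Colouring) {a a′ b} → E a s → F a b → F a′ b → a′ ≢ a → c (a′ , b) ∈₂ (c i , c i′)
      far c as ab a′b a′≢a with refl ← lone (F-row≢r ab) as = Sum.map (cong c) (cong c) (ahead ab a′b a′≢a)

    slot : ∀ {s} → E r s → Slot s
    slot {s} rs with atMost₁ (λ a → E? a s ×-dec ¬? (a ≟ r)) (atMost-remove _≟_ rs (thin rs))
    -- Row `r` is empty in `F`, so the conditions on old edges are vacuous and the remaining entries
    -- arbitrary.
    ... | inj₁ none = record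
      { t = r ; q = s ; q′ = s ; i = s , s ; i′ = s , s
      ; lone = λ a≢r as → contradiction (as , a≢r) (none _)
      ; root = λ r≢r → contradiction refl r≢r
      ; fork = λ rb → contradiction refl (F-row≢r rb)
      ; tight = λ s≢s → contradiction refl s≢s
      ; ahead = λ rb → contradiction refl (F-row≢r rb)
      }
    ... | inj₂ (t , (ts , t≢r) , only)
      with atMost₂ s (F? t) (atMost-⊆ (λ { (tb , ¬rb) → tb , λ { refl → ¬rb rs } }) (atMost-remove _≟_ ts (rows t)))
         | atMost₂ (s , s) (beyond-dec E? sparse t s) (beyond E? sparse ts)
    ... | q , q′ , fork , exact | i , i′ , ahead , _ = record
      { t = t ; q = q ; q′ = q′ ; i = i ; i′ = i′
      ; lone = λ a≢r as → only (as , a≢r)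
      ; root = λ _ → ts
      ; fork = fork
      ; tight = tight
      ; ahead = λ (tb , ¬rb) (ab , _) a≢t → ahead ((tb , λ { refl → ¬rb rs }) , (ab , a≢t))
      }
      where
      -- With `s`, `q` and `q′` the row `t` has three columns, so `ends` must bound its columns
      -- instead.
      tight : q ≢ q′ → F t q × F t q′ × AtMost 2 (flip F q) × AtMost 2 (flip F q′)
      tight q≢q′ with exact q≢q′
      ... | tq@(etq , ¬rq) , tq′@(etq′ , ¬rq′) = tq , tq′ , col etq , col etq′
        where
        col : ∀ {b} → E t b → AtMost 2 (flip F b)
        col tb with ends tb
        ... | inj₁ m = ⊥-elim (atMost₂-overfull _≟_ m ts etq etq′ (λ { refl → ¬rq rs }) (λ { refl → ¬rq′ rs }) (≢-sym q≢q′))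
        ... | inj₂ m = atMost-⊆ proj₁ m

    extend-two : ∀ {s s′} → E r s → E r s′ → (∀ {b} → E r b → b ≡ s ⊎ b ≡ s′) → Colourable F → Colourable E
    extend-two {s} {s′} rs rs′ cover (c , proper) =
      extend {s = pair s s′} ([ (zero ,_) , (suc zero ,_) ]′ ∘ cover) proper
             (λ { {zero} → S.near c ; {suc zero} → S′.near c })
             (λ { {zero} → S.far c ; {suc zero} → S′.far c })
             (proj₁ A) (λ i≢j _ _ _ → proj₂ A i≢j)
      where
      module S = Slot (slot rs)
      module S′ = Slot (slot rs′)
      A = assign-two (pair (c (S.t , S.q)) (c (S′.t , S′.q))) (pair (c (S.t , S.q′)) (c (S′.t , S′.q′)))
                     (pair (c S.i) (c S′.i)) (pair (c S.i′) (c S′.i′))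

    cover₃ : ∀ {s₀ s₁ s₂ b : Fin n} → b ≡ s₀ ⊎ b ≡ s₁ ⊎ b ≡ s₂ → ∃ λ i → b ≡ triple s₀ s₁ s₂ i
    cover₃ = [ (zero ,_) , [ (suc zero ,_) , (suc (suc zero) ,_) ]′ ]′

    -- The degree bounds make the two rows and three columns a whole component, so its six edges
    -- take the six colours and no old edge is near.
    extend-K₂₃ : ∀ {s₀ s₁ s₂ t} → E r s₀ → E r s₁ → E r s₂ → s₁ ≢ s₀ → s₂ ≢ s₀ → s₂ ≢ s₁ →
                 (∀ {b} → E r b → b ≡ s₀ ⊎ b ≡ s₁ ⊎ b ≡ s₂) →
                 t ≢ r → E t s₀ → E t s₁ → E t s₂ → Colourable F → Colourable E
    extend-K₂₃ {s₀} {s₁} {s₂} {t} rs₀ rs₁ rs₂ ≢₁₀ ≢₂₀ ≢₂₁ cover t≢r ts₀ ts₁ ts₂ (c , proper) =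
      extend {s = triple s₀ s₁ s₂} {Y} {Y} {Y} {Y} (cover₃ ∘ cover) proper
             (λ {i} as ab → ⊥-elim (isolated i as ab)) (λ {i} as ab → ⊥-elim (isolated i as ab))
             (record
               { o = o
               ; x = x
               ; o-distinct = triple-distinct (λ ()) (λ ()) (λ ())
               ; o≢x = all₃ (all₃ (λ ()) (λ ()) (λ ())) (all₃ (λ ()) (λ ()) (λ ())) (all₃ (λ ()) (λ ()) (λ ()))
               ; o-avoids = all₃ ((λ ()) ∷ (λ ()) ∷ []) ((λ ()) ∷ (λ ()) ∷ []) ((λ ()) ∷ (λ ()) ∷ [])
               ; x-avoids = all₃ ((λ ()) ∷ (λ ()) ∷ (λ ()) ∷ (λ ()) ∷ []) ((λ ()) ∷ (λ ()) ∷ (λ ()) ∷ (λ ()) ∷ [])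
                                 ((λ ()) ∷ (λ ()) ∷ (λ ()) ∷ (λ ()) ∷ [])
               })
             (λ i≢j _ _ _ → triple-distinct (λ ()) (λ ()) (λ ()) i≢j)
      where
      Y o x : Palette
      o = triple (# 0) (# 1) (# 2)
      x = triple (# 3) (# 4) (# 5)
      -- Any `Y` with `Y i` different from `o i` and `x i` will do; it also serves as `Z`, `I` and
      -- `J`.
      Y = triple (# 1) (# 2) (# 0)
      isolated : ∀ i {a b} → E a (triple s₀ s₁ s₂ i) → ¬ F a b
      isolated i {a} {b} as ab@(eab , ¬rb)
        with refl ← other-row-unique (all₃ {λ i → E r (triple s₀ s₁ s₂ i)} rs₀ rs₁ rs₂ i) (F-row≢r ab) t≢r as
                                     (all₃ {λ i → E t (triple s₀ s₁ s₂ i)} ts₀ ts₁ ts₂ i) =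
        atMost₂-overfull _≟_ (atMost-remove _≟_ ts₀ (rows t)) (ts₁ , ≢₁₀) (ts₂ , ≢₂₀) (eab , λ { refl → ¬rb rs₀ })
          ≢₂₁ (λ { refl → ¬rb rs₁ }) (λ { refl → ¬rb rs₂ })

    extend-shared : ∀ {s₀ s₁ s₂ t} → E r s₀ → E r s₁ → E r s₂ → s₁ ≢ s₀ → s₂ ≢ s₀ → s₂ ≢ s₁ →
                    (∀ {b} → E r b → b ≡ s₀ ⊎ b ≡ s₁ ⊎ b ≡ s₂) →
                    t ≢ r → E t s₀ → E t s₁ → Colourable F → Colourable E
    extend-shared {s₀} {s₁} {s₂} {t} rs₀ rs₁ rs₂ ≢₁₀ ≢₂₀ ≢₂₁ cover t≢r ts₀ ts₁ (c , proper) with E? t s₂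
    ... | yes ts₂ = extend-K₂₃ rs₀ rs₁ rs₂ ≢₁₀ ≢₂₀ ≢₂₁ cover t≢r ts₀ ts₁ ts₂ (c , proper)
    ... | no ¬ts₂ =
      extend {s = triple s₀ s₁ s₂} {triple y y (c (S.t , S.q))} {triple y y (c (S.t , S.q′))}
             {triple i i (c S.i)} {triple i i (c S.i′)}
             (cover₃ ∘ cover) proper
             (λ { {zero} as ab → near₀ (meet rs₀ ts₀ as ab) ab ; {suc zero} as ab → near₀ (meet rs₁ ts₁ as ab) ab
                ; {suc (suc zero)} → S.near c })
             (λ { {zero} as ab a′b → far₀ (meet rs₀ ts₀ as ab) ab a′b ; {suc zero} as ab a′b → far₀ (meet rs₁ ts₁ as ab) ab a′b
                ; {suc (suc zero)} → S.far c })
             (proj₁ A) x-shared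
      where
      module S = Slot (slot rs₂)

      -- Besides `s₀` and `s₁` the row `t` has at most one column `q`. If it exists, `t` has degree
      -- three, so `q` has at most one further row. The colour `zero` stands in for an absent edge.
      tail : ∃ λ y → ∃ λ i → (∀ {b} → F t b → c (t , b) ≡ y) × (∀ {a b} → F t b → F a b → a ≢ t → c (a , b) ≡ i)
      tail with atMost₁ (F? t) (atMost-⊆ (λ { (tb , ¬rb) → (tb , λ { refl → ¬rb rs₀ }) , λ { refl → ¬rb rs₁ } })
                                         (atMost-remove _≟_ (ts₁ , ≢₁₀) (atMost-remove _≟_ ts₀ (rows t))))
      ... | inj₁ none = zero , zero , (λ tb → contradiction tb (none _)) , (λ tb → contradiction tb (none _))
      ... | inj₂ (q , (tq , ¬rq) , only) with ends tq
      ...   | inj₁ m = ⊥-elim (atMost₂-overfull _≟_ m ts₀ ts₁ tq ≢₁₀ (λ { refl → ¬rq rs₀ }) (λ { refl → ¬rq rs₁ }))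
      ...   | inj₂ m with atMost₁ (λ a → E? a q ×-dec ¬? (a ≟ t)) (atMost-remove _≟_ tq m)
      ...     | inj₁ none = c (t , q) , zero , (λ tb → cong (λ b → c (t , b)) (only tb)) ,
                            λ { tb (ab , _) a≢t → case only tb of λ { refl → contradiction (ab , a≢t) (none _) } }
      ...     | inj₂ (u , _ , only′) = c (t , q) , c (u , q) , (λ tb → cong (λ b → c (t , b)) (only tb)) ,
                            λ { tb (ab , _) a≢t → case only tb of λ { refl → cong (λ a → c (a , q)) (only′ (ab , a≢t)) } }

      y i : Colour
      y = proj₁ tail
      i = proj₁ (proj₂ tail)

      A = assign-shared y i (c (S.t , S.q)) (c (S.t , S.q′)) (c S.i) (c S.i′)

      meet : ∀ {s a b} → E r s → E t s → E a s → F a b → a ≡ t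
      meet rs ts as ab = other-row-unique rs (F-row≢r ab) t≢r as ts

      near₀ : ∀ {a b} → a ≡ t → F a b → c (a , b) ∈₂ (y , y)
      near₀ refl tb = inj₁ (proj₁ (proj₂ (proj₂ tail)) tb)

      far₀ : ∀ {a a′ b} → a ≡ t → F a b → F a′ b → a′ ≢ a → c (a′ , b) ∈₂ (i , i)
      far₀ refl tb ab a≢t = inj₁ (proj₂ (proj₂ (proj₂ tail)) tb ab a≢t)

      lonely : ∀ {a s} {P : Set} → E r s → E t s → a ≢ r → E a s → E a s₂ → P
      lonely rs ts a≢r as as₂ = contradiction (subst (λ a → E a s₂) (other-row-unique rs a≢r t≢r as ts) as₂) ¬ts₂

      x-shared : ∀ {i j a} → i ≢ j → a ≢ r → E a (triple s₀ s₁ s₂ i) → E a (triple s₀ s₁ s₂ j) →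
                 Assignment.x (proj₁ A) i ≢ Assignment.x (proj₁ A) j
      x-shared {zero} {zero} i≢j = contradiction refl i≢j
      x-shared {zero} {suc zero} _ _ _ _ = proj₂ A
      x-shared {zero} {suc (suc zero)} _ a≢r = lonely rs₀ ts₀ a≢r
      x-shared {suc zero} {zero} _ _ _ _ = ≢-sym (proj₂ A)
      x-shared {suc zero} {suc zero} i≢j = contradiction refl i≢j
      x-shared {suc zero} {suc (suc zero)} _ a≢r = lonely rs₁ ts₁ a≢r
      x-shared {suc (suc zero)} {zero} _ a≢r as₂ as = lonely rs₀ ts₀ a≢r as as₂
      x-shared {suc (suc zero)} {suc zero} _ a≢r as₂ as = lonely rs₁ ts₁ a≢r as as₂
      x-shared {suc (suc zero)} {suc (suc zero)} i≢j = contradiction refl i≢j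

    F-sparse : Sparse F
    F-sparse = sparse-⊆ proj₁ sparse

    -- In the rigid case the pair at t_0 is recoloured to contain a new colour `z`, while t_1 keeps
    -- the old pair by stability. Were the result rigid again, `z` would occur at t_1 and so be old.
    extend-unshared : ∀ {s : Fin 3 → Fin n} → (∀ i → E r (s i)) → (∀ {b} → E r b → ∃ λ i → b ≡ s i) →
                      (∀ {i j a} → i ≢ j → a ≢ r → E a (s i) → ¬ E a (s j)) → Colourable F → Colourable E
    extend-unshared {s} rs cover unshared (c , proper) = first (assign (Y c) (Z c) (I c) (J c))
      where
      module S (i : Fin 3) = Slot (slot (rs i))

      Y Z I J : Colouring → Palette
      Y c i = c (S.t i , S.q i)
      Z c i = c (S.t i , S.q′ i)
      I c i = c (S.i i)
      J c i = c (S.i′ i)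

      finish : ∀ c → Proper F c → Assignment (Y c) (Z c) (I c) (J c) → Colourable E
      finish c proper A = extend cover proper (λ {i} → S.near i c) (λ {i} → S.far i c) A
                                 (λ i≢j a≢r as as′ → contradiction as′ (unshared i≢j a≢r as))

      first : Rigid (Y c) (Z c) ⊎ Assignment (Y c) (Z c) (I c) (J c) → Colourable E
      first (inj₂ A) = finish c proper A
      first (inj₁ (Y≢Z , sub)) with S.tight zero (λ e → Y≢Z (cong (λ q → c (S.t zero , q)) e))
      ... | tq , tq′ , col , col′
        with recolour F? F-sparse {c = c} proper tq tq′ (λ e → Y≢Z (cong (λ q → c (S.t zero , q)) e)) (S.fork zero) col col′
      ... | c′ , proper′ , stable , z , z∈ , z∉ with assign (Y c′) (Z c′) (I c′) (J c′)
      ...   | inj₂ A = finish c′ proper′ A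
      ...   | inj₁ (_ , sub′) = contradiction ([ Y₁-old , Z₁-old ]′ z∈₁) z∉
        where
        t₁≢t₀ : S.t (suc zero) ≢ S.t zero
        t₁≢t₀ e = unshared {zero} {suc zero} (λ ()) t₀≢r (S.root zero t₀≢r)
                    (subst (λ t → E t (s (suc zero))) e (S.root (suc zero) (t₀≢r ∘ trans (sym e))))
          where t₀≢r = F-row≢r tq

        widen : ∀ {k y y′ p} → y ∈₂ p → y′ ∈₂ p → k ∈₂ (y , y′) → k ∈₂ p
        widen y∈ y′∈ (inj₁ refl) = y∈
        widen y∈ y′∈ (inj₂ refl) = y′∈

        -- The inclusions in `Rigid` run forwards only, so the way from index 1 back to 0 leads
        -- through 2.
        old : ∀ {k} → k ∈₂ (Y c (suc zero) , Z c (suc zero)) → k ∈₂ (Y c zero , Z c zero)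
        old k∈ = widen (proj₁ (sub (suc (suc zero)))) (proj₂ (sub (suc (suc zero))))
                   (widen (proj₁ (sub (suc zero))) (proj₂ (sub (suc zero))) k∈)

        z∈₁ : z ∈₂ (Y c′ (suc zero) , Z c′ (suc zero))
        z∈₁ = widen (proj₁ (sub′ zero)) (proj₂ (sub′ zero)) z∈

        Y₁-old : z ≡ Y c′ (suc zero) → z ∈₂ (Y c zero , Z c zero)
        Y₁-old e = old (inj₁ (trans e (stable t₁≢t₀ (old (inj₁ refl)))))

        Z₁-old : z ≡ Z c′ (suc zero) → z ∈₂ (Y c zero , Z c zero)
        Z₁-old e = old (inj₂ (trans e (stable t₁≢t₀ (old (inj₂ refl)))))

    Shared : Fin n → Fin n → Set
    Shared s s′ = ∃ λ a → a ≢ r × E a s × E a s′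

    shared? : ∀ s s′ → Dec (Shared s s′)
    shared? s s′ = any? λ a → ¬? (a ≟ r) ×-dec (E? a s ×-dec E? a s′)

    extend-three : ∀ {s₀ s₁ s₂} → E r s₀ → E r s₁ → E r s₂ → s₁ ≢ s₀ → s₂ ≢ s₀ → s₂ ≢ s₁ →
                   (∀ {b} → E r b → b ≡ s₀ ⊎ b ≡ s₁ ⊎ b ≡ s₂) → Colourable F → Colourable E
    extend-three {s₀} {s₁} {s₂} rs₀ rs₁ rs₂ ≢₁₀ ≢₂₀ ≢₂₁ cover colourable
      with shared? s₀ s₁ | shared? s₁ s₂ | shared? s₂ s₀
    ... | yes (t , t≢r , ts₀ , ts₁) | _ | _ = extend-shared rs₀ rs₁ rs₂ ≢₁₀ ≢₂₀ ≢₂₁ cover t≢r ts₀ ts₁ colourable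
    ... | no _ | yes (t , t≢r , ts₁ , ts₂) | _ =
      extend-shared rs₁ rs₂ rs₀ ≢₂₁ (≢-sym ≢₁₀) (≢-sym ≢₂₀) (turn ∘ cover) t≢r ts₁ ts₂ colourable
      where
      turn : ∀ {P Q R : Set} → P ⊎ Q ⊎ R → Q ⊎ R ⊎ P
      turn = [ inj₂ ∘ inj₂ , [ inj₁ , inj₂ ∘ inj₁ ]′ ]′
    ... | no _ | no _ | yes (t , t≢r , ts₂ , ts₀) =
      extend-shared rs₂ rs₀ rs₁ (≢-sym ≢₂₀) (≢-sym ≢₂₁) ≢₁₀ (turn ∘ cover) t≢r ts₂ ts₀ colourable
      where
      turn : ∀ {P Q R : Set} → P ⊎ Q ⊎ R → R ⊎ P ⊎ Q
      turn = [ inj₂ ∘ inj₁ , [ inj₂ ∘ inj₂ , inj₁ ]′ ]′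
    ... | no ¬₀₁ | no ¬₁₂ | no ¬₂₀ =
      extend-unshared {triple s₀ s₁ s₂} (all₃ rs₀ rs₁ rs₂) (cover₃ ∘ cover) unshared colourable
      where
      unshared : ∀ {i j a} → i ≢ j → a ≢ r → E a (triple s₀ s₁ s₂ i) → ¬ E a (triple s₀ s₁ s₂ j)
      unshared {zero} {zero} i≢j = contradiction refl i≢j
      unshared {zero} {suc zero} _ a≢r e f = ¬₀₁ (_ , a≢r , e , f)
      unshared {zero} {suc (suc zero)} _ a≢r e f = ¬₂₀ (_ , a≢r , f , e)
      unshared {suc zero} {zero} _ a≢r e f = ¬₀₁ (_ , a≢r , f , e)
      unshared {suc zero} {suc zero} i≢j = contradiction refl i≢j
      unshared {suc zero} {suc (suc zero)} _ a≢r e f = ¬₁₂ (_ , a≢r , e , f)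
      unshared {suc (suc zero)} {zero} _ a≢r e f = ¬₂₀ (_ , a≢r , e , f)
      unshared {suc (suc zero)} {suc zero} _ a≢r e f = ¬₁₂ (_ , a≢r , f , e)
      unshared {suc (suc zero)} {suc (suc zero)} i≢j = contradiction refl i≢j

    step : Colourable F → Colourable E
    step colourable@(c , proper) with atMost-exact (E? r) (rows r)
    ... | [] , _ , cover , _ = c , λ (ab , a′b′ , join , e≢f) → proper (keep ab , keep a′b′ , Sum.map keep keep join , e≢f)
      where
      keep : ∀ {a b} → E a b → F a b
      keep ab = ab , λ rb → case cover rb of λ ()
    -- A single column is entered twice; the cover only ever points to the first copy.
    ... | s ∷ [] , _ , cover , rs ∷ [] = extend-two rs rs (λ rb → case cover rb of λ { (here e) → inj₁ e }) colourable
    ... | s₀ ∷ s₁ ∷ [] , _ , cover , rs₀ ∷ rs₁ ∷ [] =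
      extend-two rs₀ rs₁ (λ rb → case cover rb of λ { (here e) → inj₁ e ; (there (here e)) → inj₂ e }) colourable
    ... | _ ∷ _ ∷ _ ∷ _ ∷ _ , s≤s (s≤s (s≤s ())) , _
    ... | s₀ ∷ s₁ ∷ s₂ ∷ [] , _ , cover , rs₀ ∷ rs₁ ∷ rs₂ ∷ [] = cases (s₁ ≟ s₀) (s₂ ≟ s₀) (s₂ ≟ s₁)
      where
      cover′ : ∀ {b} → E r b → b ≡ s₀ ⊎ b ≡ s₁ ⊎ b ≡ s₂
      cover′ rb = case cover rb of λ
        { (here e) → inj₁ e ; (there (here e)) → inj₂ (inj₁ e) ; (there (there (here e))) → inj₂ (inj₂ e) }
      -- The covering list may repeat a column, and then two columns cover the row.
      cases : Dec (s₁ ≡ s₀) → Dec (s₂ ≡ s₀) → Dec (s₂ ≡ s₁) → Colourable E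
      cases (yes refl) _ _ = extend-two rs₀ rs₂ ([ inj₁ , [ inj₁ , inj₂ ]′ ]′ ∘ cover′) colourable
      cases (no _) (yes refl) _ = extend-two rs₀ rs₁ ([ inj₁ , [ inj₂ , inj₁ ]′ ]′ ∘ cover′) colourable
      cases (no _) (no _) (yes refl) = extend-two rs₀ rs₁ ([ inj₁ , [ inj₂ , inj₂ ]′ ]′ ∘ cover′) colourable
      cases (no ≢₁₀) (no ≢₂₀) (no ≢₂₁) = extend-three rs₀ rs₁ rs₂ ≢₁₀ ≢₂₀ ≢₂₁ cover′ colourable

  -- Induction over the rows

  -- `rs` lists the rows that may still have edges. Thin columns make every row reducible, and they
  -- stay thin under deletion.
  colour-thin-cols : ∀ rs {E : Edges} → (∀ a b → Dec (E a b)) → Sparse E → (∀ b → AtMost 2 (flip E b)) →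
                     (∀ {a} → a ∉ rs → ∀ b → ¬ E a b) → Colourable E
  colour-thin-cols [] E? sparse thin empty = (λ _ → zero) , λ (e , _) → contradiction e (empty (λ ()) _)
  colour-thin-cols (r ∷ rs) {E} E? sparse thin empty =
    step (colour-thin-cols rs F? F-sparse (λ b → atMost-⊆ proj₁ (thin b)) empty′)
    where
    open Step E? sparse r (λ {b} _ → thin b)
    empty′ : ∀ {a} → a ∉ rs → ∀ b → ¬ F a b
    empty′ a∉rs b ab = empty (λ { (here e) → F-row≢r ab e ; (there i) → a∉rs i }) b (proj₁ ab)

  sparse-flip : ∀ {E} → Sparse E → Sparse (flip E)
  sparse-flip sparse = record { rows = cols ; cols = rows ; ends = Sum.swap ∘ ends }
    where open Sparse sparse

  colourable-flip : ∀ {E} → Colourable (flip E) → Colourable E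
  colourable-flip (c , proper) =
    c ∘ swap , λ (e , f , join , e≢f) → proper (e , f , Sum.swap join , e≢f ∘ cong swap)

  -- Each listed row is either thin, and struck off, or has thin columns, and is removed by `step`.
  -- When the list is exhausted all rows are thin, and exchanging rows and columns leads to
  -- `colour-thin-cols`.
  colour-sparse : ∀ rs {E : Edges} → (∀ a b → Dec (E a b)) → Sparse E → (∀ {a} → a ∉ rs → AtMost 2 (E a)) → Colourable E
  colour-sparse [] E? sparse thin =
    colourable-flip (colour-thin-cols (allFin n) (flip E?) (sparse-flip sparse) (λ a → thin λ ())
                                      (λ a∉ → contradiction (∈-allFin _) a∉))
  colour-sparse (r ∷ rs) {E} E? sparse thin with thin-row-or-cols E? sparse r
  ... | inj₁ thin-r = colour-sparse rs E? sparse thin′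
    where
    thin′ : ∀ {a} → a ∉ rs → AtMost 2 (E a)
    thin′ {a} a∉rs with a ≟ r
    ... | yes refl = thin-r
    ... | no a≢r = thin λ { (here e) → a≢r e ; (there i) → a∉rs i }
  ... | inj₂ thin-cols = step (colour-sparse rs F? F-sparse thin′)
    where
    open Step E? sparse r (λ {b} → thin-cols b)
    thin′ : ∀ {a} → a ∉ rs → AtMost 2 (F a)
    thin′ {a} a∉rs with a ≟ r
    ... | yes refl = [] , z≤n , λ rb → contradiction refl (F-row≢r rb)
    ... | no a≢r = atMost-⊆ proj₁ (thin λ { (here e) → a≢r e ; (there i) → a∉rs i })

-- From bipartite graphs to row-column relations and back

module _ {n : ℕ} (G : Graph n) where
  open Graph G renaming (sym to adj-sym)

  edge? : ∀ u v → Dec (Edge G u v)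
  edge? u v = adj u v Bool.≟ true

  edge-sym : ∀ {u v} → Edge G u v → Edge G v u
  edge-sym {u} {v} = trans (adj-sym v u)

  length-filter-edge : ∀ u l → length (filter (edge? u) l) ≡ sum (map (λ v → if adj u v then 1 else 0) l)
  length-filter-edge u [] = refl
  length-filter-edge u (v ∷ l) with adj u v
  ... | true = cong suc (length-filter-edge u l)
  ... | false = length-filter-edge u l

  deg-bounds : ∀ {k} u → deg G u ≤ k → AtMost k (Edge G u)
  deg-bounds u len =
    filter (edge? u) (allFin n) , ≤-trans (≤-reflexive (length-filter-edge u (allFin n))) len ,
    ∈-filter⁺ (edge? u) (∈-allFin _)

  close-swapˡ : ∀ {u v x y} → Close G u v x y → Close G v u x y
  close-swapˡ (inj₁ (inj₁ e)) = inj₁ (inj₂ (inj₂ (inj₁ e)))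
  close-swapˡ (inj₁ (inj₂ (inj₁ e))) = inj₁ (inj₂ (inj₂ (inj₂ e)))
  close-swapˡ (inj₁ (inj₂ (inj₂ (inj₁ e)))) = inj₁ (inj₁ e)
  close-swapˡ (inj₁ (inj₂ (inj₂ (inj₂ e)))) = inj₁ (inj₂ (inj₁ e))
  close-swapˡ (inj₂ (inj₁ e)) = inj₂ (inj₂ (inj₂ (inj₁ e)))
  close-swapˡ (inj₂ (inj₂ (inj₁ e))) = inj₂ (inj₂ (inj₂ (inj₂ e)))
  close-swapˡ (inj₂ (inj₂ (inj₂ (inj₁ e)))) = inj₂ (inj₁ e)
  close-swapˡ (inj₂ (inj₂ (inj₂ (inj₂ e)))) = inj₂ (inj₂ (inj₁ e))

  close-swapʳ : ∀ {u v x y} → Close G u v x y → Close G u v y x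
  close-swapʳ (inj₁ (inj₁ e)) = inj₁ (inj₂ (inj₁ e))
  close-swapʳ (inj₁ (inj₂ (inj₁ e))) = inj₁ (inj₁ e)
  close-swapʳ (inj₁ (inj₂ (inj₂ (inj₁ e)))) = inj₁ (inj₂ (inj₂ (inj₂ e)))
  close-swapʳ (inj₁ (inj₂ (inj₂ (inj₂ e)))) = inj₁ (inj₂ (inj₂ (inj₁ e)))
  close-swapʳ (inj₂ (inj₁ e)) = inj₂ (inj₂ (inj₁ e))
  close-swapʳ (inj₂ (inj₂ (inj₁ e))) = inj₂ (inj₁ e)
  close-swapʳ (inj₂ (inj₂ (inj₂ (inj₁ e)))) = inj₂ (inj₂ (inj₂ (inj₂ e)))
  close-swapʳ (inj₂ (inj₂ (inj₂ (inj₂ e)))) = inj₂ (inj₂ (inj₂ (inj₁ e)))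

  sameEdge-swapʳ : ∀ {u v x y} → SameEdge G u v y x → SameEdge G u v x y
  sameEdge-swapʳ = Sum.swap

  sameEdge-swapˡ : ∀ {u v x y} → SameEdge G v u x y → SameEdge G u v x y
  sameEdge-swapˡ = [ inj₂ ∘ swap , inj₁ ∘ swap ]′

  module _ (side : Fin n → Bool) (bipartite : ∀ u v → Edge G u v → side u ≢ side v) where

    -- Rows are the vertices on the `true` side, so each edge of the graph appears in exactly one
    -- orientation.
    Crossing : Fin n → Fin n → Set
    Crossing a b = side a ≡ true × Edge G a b

    crossing? : ∀ a b → Dec (Crossing a b)
    crossing? a b = (side a Bool.≟ true) ×-dec edge? a b

    crossing-sparse : MaxDegreeAtMost G 3 → (∀ u v → Edge G u v → deg G u + deg G v ≤ 5) → Sparse Crossing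
    crossing-sparse max ore = record
      { rows = λ a → atMost-⊆ proj₂ (deg-bounds a (max a))
      ; cols = λ b → atMost-⊆ (edge-sym ∘ proj₂) (deg-bounds b (max b))
      ; ends = λ {a} {b} (_ , ab) → ends a b ab
      }
      where
      -- A degree of at least 3 at `a` leaves at most 5 - 3 = 2 for `b`.
      ends : ∀ a b → Edge G a b → AtMost 2 (Crossing a) ⊎ AtMost 2 (flip Crossing b)
      ends a b ab with deg G a ≤? 2
      ... | yes small = inj₁ (atMost-⊆ proj₂ (deg-bounds a small))
      ... | no large = inj₂ (atMost-⊆ (edge-sym ∘ proj₂) (deg-bounds b
              (+-cancelˡ-≤ 3 (deg G b) 2 (≤-trans (+-monoˡ-≤ (deg G b) (≰⇒> large)) (ore a b ab)))))

    module _ (c : Fin n × Fin n → Colour) (proper : Proper Crossing c) where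

      oriented : Fin n → Fin n → Colour
      oriented u v = if side u then c (u , v) else c (v , u)

      oriented-sym : ∀ u v → Edge G u v → oriented u v ≡ oriented v u
      oriented-sym u v uv with side u | side v | bipartite u v uv
      ... | true | true | ≢ = contradiction refl ≢
      ... | true | false | _ = refl
      ... | false | true | _ = refl
      ... | false | false | ≢ = contradiction refl ≢

      oriented-true : ∀ {u v} → side u ≡ true → oriented u v ≡ c (u , v)
      oriented-true eq rewrite eq = refl

      -- Adjacency or equality between a row and a column of the wrong kind contradicts the
      -- bipartition. What remains is one of the two joins in `Conflict`; at a common endpoint one
      -- of the two edges itself provides it.
      crossing-strong : ∀ {a b a′ b′} → Crossing a b → Crossing a′ b′ → ¬ SameEdge G a b a′ b′ →
                        Close G a b a′ b′ → c (a , b) ≢ c (a′ , b′)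
      crossing-strong {a} {b} {a′} {b′} e@(sa , ab) f@(sa′ , a′b′) distinct close =
        proper (e , f , join close , λ { refl → distinct (inj₁ (refl , refl)) })
        where
        join : Close G a b a′ b′ → Crossing a b′ ⊎ Crossing a′ b
        join (inj₁ (inj₁ refl)) = inj₁ f
        join (inj₁ (inj₂ (inj₁ refl))) = contradiction (trans sa′ (sym sa)) (bipartite _ _ a′b′)
        join (inj₁ (inj₂ (inj₂ (inj₁ refl)))) = contradiction (trans sa (sym sa′)) (bipartite _ _ ab)
        join (inj₁ (inj₂ (inj₂ (inj₂ refl)))) = inj₁ e
        join (inj₂ (inj₁ aa′)) = contradiction (trans sa (sym sa′)) (bipartite _ _ aa′)
        join (inj₂ (inj₂ (inj₁ ab′))) = inj₁ (sa , ab′)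
        join (inj₂ (inj₂ (inj₂ (inj₁ ba′)))) = inj₂ (sa′ , edge-sym ba′)
        join (inj₂ (inj₂ (inj₂ (inj₂ bb′)))) = contradiction (trans (other ab sa) (sym (other a′b′ sa′))) (bipartite _ _ bb′)
          where
          other : ∀ {u v} → Edge G u v → side u ≡ true → side v ≡ false
          other {u} {v} uv su with side v in sv
          ... | false = refl
          ... | true = contradiction (trans su (sym sv)) (bipartite u v uv)

      orient : ∀ {u v} → Edge G u v → side u ≡ true ⊎ side v ≡ true
      orient {u} {v} uv with side u in su | side v in sv
      ... | true | _ = inj₁ refl
      ... | false | true = inj₂ refl
      ... | false | false = contradiction (trans su (sym sv)) (bipartite u v uv)

      oriented-strong : ∀ u v x y → Edge G u v → Edge G x y → ¬ SameEdge G u v x y → Close G u v x y →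
                        oriented u v ≢ oriented x y
      oriented-strong u v x y uv xy distinct close = cases (orient uv) (orient xy)
        where
        cases : side u ≡ true ⊎ side v ≡ true → side x ≡ true ⊎ side y ≡ true → oriented u v ≢ oriented x y
        cases (inj₁ su) (inj₁ sx) rewrite oriented-true {u} {v} su | oriented-true {x} {y} sx =
          crossing-strong (su , uv) (sx , xy) distinct close
        cases (inj₁ su) (inj₂ sy) rewrite oriented-true {u} {v} su | oriented-sym x y xy | oriented-true {y} {x} sy =
          crossing-strong (su , uv) (sy , edge-sym xy) (distinct ∘ sameEdge-swapʳ) (close-swapʳ close)
        cases (inj₂ sv) (inj₁ sx) rewrite oriented-sym u v uv | oriented-true {v} {u} sv | oriented-true {x} {y} sx =
          crossing-strong (sv , edge-sym uv) (sx , xy) (distinct ∘ sameEdge-swapˡ) (close-swapˡ close)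
        cases (inj₂ sv) (inj₂ sy)
          rewrite oriented-sym u v uv | oriented-true {v} {u} sv | oriented-sym x y xy | oriented-true {y} {x} sy =
          crossing-strong (sv , edge-sym uv) (sy , edge-sym xy) (distinct ∘ sameEdge-swapˡ ∘ sameEdge-swapʳ)
                          (close-swapˡ (close-swapʳ close))

theorem7 : (n : ℕ) (G : Graph n) → Bipartite G → MaxDegreeAtMost G 3 →
    (∀ u v → Edge G u v → deg G u + deg G v ≤ 5) →
    StrongChromaticIndexAtMost G 6
theorem7 n G (side , bipartite) max ore
  with colour-sparse (allFin n) (crossing? G side bipartite) (crossing-sparse G side bipartite max ore)
                     (λ a∉ → contradiction (∈-allFin _) a∉)
... | c , proper = record
  { colour     = oriented G side bipartite c proper
  ; colour-sym = oriented-sym G side bipartite c proper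
  ; strong     = oriented-strong G side bipartite c proper
  }
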